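{- Let $\alpha, \nu, \gamma, \mu$ be real numbers with $\alpha > \nu \ge 1$, $\gamma > 1$, $\mu > 0$, and $\alpha > \nu\cdot\gamma$. Let $\mathcal{P}$ be an $\alpha$-OR-decomposable problem with parameter $n_{\mathcal{P}}$ that $(\nu,\mu)$-OR-cross-composes into a problem $\mathcal{Q}$ with parameters $n_{\mathcal{Q}}$ and $\ell_{\mathcal{Q}}$. Assume that there is an $\widetilde O(n_{\mathcal Q}^{\xi})$-time algorithm for deciding $\mathcal Q$, where $\xi>0$, and that $n_{\mathcal Q}$ is upper bounded by the input size. If there exists an $\widetilde O(\ell_{\mathcal Q}^{\beta})$-size $\widetilde O(n_{\mathcal Q}^{\gamma})$-time kernel for $\mathcal Q$ with $\beta\in\mathbb R$ and $$0<\beta<\frac{\gamma\cdot(\alpha-\nu)}{(\gamma-1)\cdot\mu\cdot\xi},$$ then $\mathcal P$ can be solved in $O(n_{\mathcal P}^{\alpha-\varepsilon})$ time for some $\varepsilon>0$.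
   Context: The notation $\widetilde O$ hides polylogarithmic factors. A parameterized problem is a set of pairs $(I,p)\in\Sigma^*\times\Sigma^*$ ($\Sigma$ a finite alphabet), where $I$ is the classical instance and $p$ the parameter. Here either $p=n$ is a single nonnegative integer, or $p=(n,\ell)$ is a pair of nonnegative integers. All problems are parameterized problems. Kernel: an $\widetilde O(\ell^{\beta})$-size $\widetilde O(n^{\gamma})$-time kernel for a problem with parameters $(n,\ell)$ is an algorithm running in $\widetilde O(n^\gamma)$ time that maps any instance $(I,(n,\ell))$ to an equivalent instance $(I',p')$ of the same problem whose size $|I'|+p'$ is in $\widetilde O(\ell^\beta)$. OR-decomposition: for $\alpha>1$, an $\alpha$-OR-decomposition for a problem $\mathcal P$ (with parameter $n$) is an algorithm that, given $\lambda>0$ and an instance $(I,n)$ of $\mathcal P$, computes, for some $\alpha'<\alpha$, in $\widetilde O(n^{\alpha'})$ time $t\in\widetilde O(n^{\alpha\lambda/(\alpha+\lambda)})$ many instances $(I_1,n_1),\dots,(I_t,n_t)$ of $\mathcal P$ such that (i) $(I,n)\in\mathcal P$ if and only if $(I_i,n_i)\in\mathcal P$ for some $i\in\{1,\dots,t\}$, and (ii) $n_i\in\widetilde O(n^{\alpha/(\alpha+\lambda)})$ for all $i$. The problem $\mathcal P$ is $\alpha$-OR-decomposable if an $\alpha$-OR-decomposition for it exists. OR-cross-composition: for $\nu\ge1$, $\mu\ge0$, a $(\nu,\mu)$-OR-cross-composition from $\mathcal P$ (parameter $n$) to $\mathcal Q$ (parameters $n,\ell$) is an algorithm that takes $t$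 instances $(I_1,n_1),\dots,(I_t,n_t)$ of $\mathcal P$, runs in $\widetilde O(t\cdot n_{\max}^{\nu}+\sum_{i=1}^t|I_i|)$ time, where $n_{\max}=\max_i n_i$, and computes an instance $(J,(n_{\mathcal Q},\ell_{\mathcal Q}))$ of $\mathcal Q$ such that (i) $(J,(n_{\mathcal Q},\ell_{\mathcal Q}))\in\mathcal Q$ if and only if $(I_i,n_i)\in\mathcal P$ for some $i$, and (ii) $n_{\mathcal Q}\in\widetilde O(t\cdot n_{\max}^{\nu})$ and $\ell_{\mathcal Q}\in\widetilde O(n_{\max}^{\mu})$. If one exists, $\mathcal P$ is said to $(\nu,\mu)$-OR-cross-compose into $\mathcal Q$. -}

module Defs where

open import Data.Bool using (Bool; true; false; if_then_else_)
open import Data.Fin using (Fin; toℕ)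
open import Data.Integer using (ℤ; +_; -[1+_])
open import Data.List using (List; []; _∷_; _∷ʳ_; map; length; sum; foldr; concatMap)
open import Data.List.NonEmpty using (List⁺; toList)
open import Data.List.Relation.Unary.Any using (Any)
open import Data.Nat using (ℕ; zero; suc; _+_; _*_; _∸_; _^_; _≤_; _⊔_; _≡ᵇ_)
open import Data.Nat.DivMod using (_/_)
open import Data.Nat.Logarithm using (⌊log₂_⌋)
import Data.Nat.Properties as ℕₚ
open import Data.Product using (∃; ∃₂; _×_; _,_; proj₁; proj₂)
open import Data.Rational as ℚ using (ℚ; 0ℚ; 1ℚ; ½; 1/_; ↥_; ↧ₙ_)
import Data.Rational.Properties as ℚₚ
open import Data.Rational.Solver using (module +-*-Solver)
open import Function using (const)
open import Function.Bundles using (_⇔_)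
open import Relation.Binary.PropositionalEquality
  using (_≡_; refl; sym; trans; cong; cong₂; subst; subst₂)

-- Cauchy sequences of rationals.  Two sequences with the same limit are not
-- identified, but every relation on ℝ below respects that equivalence.

record ℝ : Set where
  field
    seq    : ℕ → ℚ
    cauchy : ∀ ε → 0ℚ ℚ.< ε →
             ∃ λ N → ∀ m n → N ≤ m → N ≤ n → ℚ.∣ seq m ℚ.- seq n ∣ ℚ.< ε

open ℝ public

infix 4 _<ʳ_ _≤ʳ_

record _<ʳ_ (x y : ℝ) : Set where
  constructor apart
  field
    δ     : ℚ
    0<δ   : 0ℚ ℚ.< δ
    N     : ℕ
    below : ∀ n → N ≤ n → seq x n ℚ.+ δ ℚ.≤ seq y n

_≤ʳ_ : ℝ → ℝ → Set
x ≤ʳ y = ∀ ε → 0ℚ ℚ.< ε → ∃ λ N → ∀ n → N ≤ n → seq x n ℚ.≤ seq y n ℚ.+ ε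

halve : ∀ {ε} → 0ℚ ℚ.< ε → 0ℚ ℚ.< ½ ℚ.* ε
halve {ε} 0<ε = subst (ℚ._< ½ ℚ.* ε) (ℚₚ.*-zeroʳ ½) (ℚₚ.*-monoʳ-<-pos ½ 0<ε)

halves : ∀ ε → ½ ℚ.* ε ℚ.+ ½ ℚ.* ε ≡ ε
halves ε = trans (sym (ℚₚ.*-distribʳ-+ ε ½ ½)) (ℚₚ.*-identityˡ ε)

pos-* : ∀ {p q} → 0ℚ ℚ.< p → 0ℚ ℚ.< q → 0ℚ ℚ.< p ℚ.* q
pos-* {p} {q} 0<p 0<q = subst (ℚ._< p ℚ.* q) (ℚₚ.*-zeroʳ p)
  (ℚₚ.*-monoʳ-<-pos p {{ℚ.positive 0<p}} 0<q)

*-mono : ∀ {p p′ q q′} → 0ℚ ℚ.≤ p′ → 0ℚ ℚ.≤ q →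
         p ℚ.≤ p′ → q ℚ.≤ q′ → p ℚ.* q ℚ.≤ p′ ℚ.* q′
*-mono {p} {p′} {q} {q′} 0≤p′ 0≤q p≤p′ q≤q′ = ℚₚ.≤-trans
  (ℚₚ.*-monoʳ-≤-nonNeg q {{ℚ.nonNegative 0≤q}} p≤p′)
  (ℚₚ.*-monoˡ-≤-nonNeg p′ {{ℚ.nonNegative 0≤p′}} q≤q′)

⊔-left : ∀ {M N k} → M ⊔ N ≤ k → M ≤ k
⊔-left {M} {N} = ℕₚ.≤-trans (ℕₚ.m≤m⊔n M N)

⊔-right : ∀ {M N k} → M ⊔ N ≤ k → N ≤ k
⊔-right {M} {N} = ℕₚ.≤-trans (ℕₚ.m≤n⊔m M N)

∣-∣-swap : ∀ p q → ℚ.∣ p ℚ.- q ∣ ≡ ℚ.∣ q ℚ.- p ∣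
∣-∣-swap p q = trans (cong ℚ.∣_∣ (solve 2 (λ p q → p :- q := :- (q :- p)) refl p q))
                     (ℚₚ.∣-p∣≡∣p∣ (q ℚ.- p))
  where open +-*-Solver

bounded : ∀ x → ∃₂ λ B N → 0ℚ ℚ.< B × (∀ n → N ≤ n → ℚ.∣ seq x n ∣ ℚ.≤ B)
bounded x = let N , c = cauchy x 1ℚ (ℚₚ.positive⁻¹ 1ℚ) ; a = seq x N in
  1ℚ ℚ.+ ℚ.∣ a ∣ , N ,
  ℚₚ.+-mono-<-≤ (ℚₚ.positive⁻¹ 1ℚ) (ℚₚ.0≤∣p∣ a) ,
  λ n N≤n → subst (ℚ._≤ 1ℚ ℚ.+ ℚ.∣ a ∣)
    (cong ℚ.∣_∣ (solve 2 (λ u v → (u :- v) :+ v := u) refl (seq x n) a))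
    (ℚₚ.≤-trans (ℚₚ.∣p+q∣≤∣p∣+∣q∣ (seq x n ℚ.- a) a)
      (ℚₚ.+-monoˡ-≤ ℚ.∣ a ∣ (ℚₚ.<⇒≤ (c n N N≤n ℕₚ.≤-refl))))
  where open +-*-Solver

pos-1/ : ∀ {p} (0<p : 0ℚ ℚ.< p) → 0ℚ ℚ.< (1/ p) {{ℚ.>-nonZero 0<p}}
pos-1/ {p} 0<p = ℚₚ.positive⁻¹ _ {{ℚₚ.1/pos⇒pos p {{ℚ.positive 0<p}}}}

ℚ⇒ℝ : ℚ → ℝ
ℚ⇒ℝ q = record
  { seq    = const q
  ; cauchy = λ ε 0<ε → 0 , λ _ _ _ _ →
      subst (ℚ._< ε) (sym (cong ℚ.∣_∣ (ℚₚ.+-inverseʳ q))) 0<ε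
  }

0ʳ 1ʳ : ℝ
0ʳ = ℚ⇒ℝ 0ℚ
1ʳ = ℚ⇒ℝ 1ℚ

infixl 6 _+ʳ_ _-ʳ_
infixl 7 _*ʳ_

_+ʳ_ : ℝ → ℝ → ℝ
x +ʳ y = record
  { seq    = λ n → seq x n ℚ.+ seq y n
  ; cauchy = λ ε 0<ε →
      let M , c = cauchy x _ (halve 0<ε)
          N , d = cauchy y _ (halve 0<ε)
      in M ⊔ N , λ m n m≥ n≥ →
        subst₂ ℚ._<_
          refl (halves ε)
          (ℚₚ.≤-<-trans
            (subst (ℚ._≤ ℚ.∣ seq x m ℚ.- seq x n ∣ ℚ.+ ℚ.∣ seq y m ℚ.- seq y n ∣)
              (cong ℚ.∣_∣ (solve 4 (λ a b c d →
                 (a :- b) :+ (c :- d) := (a :+ c) :- (b :+ d)) refl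
                 (seq x m) (seq x n) (seq y m) (seq y n)))
              (ℚₚ.∣p+q∣≤∣p∣+∣q∣ (seq x m ℚ.- seq x n) (seq y m ℚ.- seq y n)))
            (ℚₚ.+-mono-< (c m n (⊔-left m≥) (⊔-left n≥))
                         (d m n (⊔-right {M} m≥) (⊔-right {M} n≥))))
  }
  where open +-*-Solver

-ʳ_ : ℝ → ℝ
-ʳ x = record
  { seq    = λ n → ℚ.- seq x n
  ; cauchy = λ ε 0<ε → let N , c = cauchy x ε 0<ε in N , λ m n m≥ n≥ →
      subst (ℚ._< ε)
        (trans (∣-∣-swap (seq x m) (seq x n))
          (cong ℚ.∣_∣ (solve 2 (λ a b → b :- a := (:- a) :- (:- b)) refl
            (seq x m) (seq x n))))
        (c m n m≥ n≥)
  }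
  where open +-*-Solver

_-ʳ_ : ℝ → ℝ → ℝ
x -ʳ y = x +ʳ (-ʳ y)

_*ʳ_ : ℝ → ℝ → ℝ
x *ʳ y = record
  { seq    = λ n → seq x n ℚ.* seq y n
  ; cauchy = λ ε 0<ε →
      let B  , L  , 0<B  , bx = bounded x
          B′ , L′ , 0<B′ , by = bounded y
          ε₁ = (1/ B ) {{ℚ.>-nonZero 0<B }} ℚ.* (½ ℚ.* ε)
          ε₂ = (1/ B′) {{ℚ.>-nonZero 0<B′}} ℚ.* (½ ℚ.* ε)
          M , c = cauchy x ε₂ (pos-* (pos-1/ 0<B′) (halve 0<ε))
          N , d = cauchy y ε₁ (pos-* (pos-1/ 0<B ) (halve 0<ε))
      in (M ⊔ N) ⊔ (L ⊔ L′) , λ m n m≥ n≥ →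
        let u = seq x m ; u′ = seq x n ; v = seq y m ; v′ = seq y n
            m≥M⊔N = ⊔-left {M ⊔ N} m≥
            n≥M⊔N = ⊔-left {M ⊔ N} n≥
        in ℚₚ.≤-<-trans
            (subst (ℚ._≤ ℚ.∣ u ℚ.* (v ℚ.- v′) ∣ ℚ.+ ℚ.∣ v′ ℚ.* (u ℚ.- u′) ∣)
              (cong ℚ.∣_∣ (solve 4 (λ u u′ v v′ →
                 u :* (v :- v′) :+ v′ :* (u :- u′) := u :* v :- u′ :* v′) refl u u′ v v′))
              (ℚₚ.∣p+q∣≤∣p∣+∣q∣ (u ℚ.* (v ℚ.- v′)) (v′ ℚ.* (u ℚ.- u′))))
            (subst (ℚ._<_ _) (halves ε) (ℚₚ.+-mono-<
              (step B 0<B u (v ℚ.- v′) (½ ℚ.* ε)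
                (bx m (⊔-left (⊔-right {M ⊔ N} m≥)))
                (d m n (⊔-right {M} m≥M⊔N) (⊔-right {M} n≥M⊔N)))
              (step B′ 0<B′ v′ (u ℚ.- u′) (½ ℚ.* ε)
                (by n (⊔-right {L} (⊔-right {M ⊔ N} n≥)))
                (c m n (⊔-left m≥M⊔N) (⊔-left n≥M⊔N)))))
  }
  where
  open +-*-Solver
  step : ∀ B (0<B : 0ℚ ℚ.< B) p q η → ℚ.∣ p ∣ ℚ.≤ B →
         ℚ.∣ q ∣ ℚ.< (1/ B) {{ℚ.>-nonZero 0<B}} ℚ.* η → ℚ.∣ p ℚ.* q ∣ ℚ.< η
  step B 0<B p q η ∣p∣≤B ∣q∣< = subst₂ ℚ._<_ (sym (ℚₚ.∣p*q∣≡∣p∣*∣q∣ p q))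
    (trans (sym (ℚₚ.*-assoc B _ η))
      (trans (cong (ℚ._* η) (ℚₚ.*-inverseʳ B {{ℚ.>-nonZero 0<B}})) (ℚₚ.*-identityˡ η)))
    (ℚₚ.≤-<-trans
      (ℚₚ.*-monoʳ-≤-nonNeg ℚ.∣ q ∣ {{ℚₚ.∣-∣-nonNeg q}} ∣p∣≤B)
      (ℚₚ.*-monoʳ-<-pos B {{ℚ.positive 0<B}} ∣q∣<))

-- z n ⊔ δ equals z n from some index on, δ being the lower bound on z
-- contained in a proof of 0 < z.
clamp-pos : ∀ {δ} z → 0ℚ ℚ.< δ → 0ℚ ℚ.< z ℚ.⊔ δ
clamp-pos {δ} z 0<δ = ℚₚ.<-≤-trans 0<δ (ℚₚ.p≤q⊔p z δ)

infix 8 1/ʳ_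

1/ʳ_ : ∀ {z} → 0ʳ <ʳ z → ℝ
1/ʳ_ {z} (apart δ 0<δ N δ≤z) = record
  { seq    = λ n → (1/ (seq z n ℚ.⊔ δ)) {{ℚ.>-nonZero (clamp-pos (seq z n) 0<δ)}}
  ; cauchy = λ ε 0<ε →
      let M , c = cauchy z (ε ℚ.* (δ ℚ.* δ)) (pos-* 0<ε (pos-* 0<δ 0<δ))
      in M ⊔ N , λ m n m≥ n≥ →
        close 0<ε (clamp-pos (seq z m) 0<δ) (clamp-pos (seq z n) 0<δ)
          (ℚₚ.p≤q⊔p (seq z m) δ) (ℚₚ.p≤q⊔p (seq z n) δ)
          (subst₂ (λ u v → ℚ.∣ u ℚ.- v ∣ ℚ.< ε ℚ.* (δ ℚ.* δ))
            (unclamp m (⊔-right {M} m≥)) (unclamp n (⊔-right {M} n≥))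
            (c m n (⊔-left m≥) (⊔-left n≥)))
  }
  where
  open +-*-Solver
  unclamp : ∀ n → N ≤ n → seq z n ≡ seq z n ℚ.⊔ δ
  unclamp n N≤n = sym (ℚₚ.p≥q⇒p⊔q≡p
    (subst (ℚ._≤ seq z n) (ℚₚ.+-identityˡ δ) (δ≤z n N≤n)))

  close : ∀ {ε u v} → 0ℚ ℚ.< ε → (0<u : 0ℚ ℚ.< u) (0<v : 0ℚ ℚ.< v) →
          δ ℚ.≤ u → δ ℚ.≤ v → ℚ.∣ u ℚ.- v ∣ ℚ.< ε ℚ.* (δ ℚ.* δ) →
          ℚ.∣ (1/ u) {{ℚ.>-nonZero 0<u}} ℚ.- (1/ v) {{ℚ.>-nonZero 0<v}} ∣ ℚ.< ε
  close {ε} {u} {v} 0<ε 0<u 0<v δ≤u δ≤v u-v<  =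
    ℚₚ.*-cancelʳ-<-nonNeg (u ℚ.* v) {{ℚ.nonNegative (ℚₚ.<⇒≤ 0<uv)}}
      (subst (ℚ._< ε ℚ.* (u ℚ.* v)) eq
        (ℚₚ.<-≤-trans u-v<
          (ℚₚ.*-monoˡ-≤-nonNeg ε {{ℚ.nonNegative (ℚₚ.<⇒≤ 0<ε)}}
            (*-mono (ℚₚ.<⇒≤ 0<u) (ℚₚ.<⇒≤ 0<δ) δ≤u δ≤v))))
    where
    a b : ℚ
    a = (1/ u) {{ℚ.>-nonZero 0<u}}
    b = (1/ v) {{ℚ.>-nonZero 0<v}}
    0<uv : 0ℚ ℚ.< u ℚ.* v
    0<uv = pos-* 0<u 0<v
    au≡1 : a ℚ.* u ≡ 1ℚ
    au≡1 = ℚₚ.*-inverseˡ u {{ℚ.>-nonZero 0<u}}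
    bv≡1 : b ℚ.* v ≡ 1ℚ
    bv≡1 = ℚₚ.*-inverseˡ v {{ℚ.>-nonZero 0<v}}
    expand : v ℚ.- u ≡ (a ℚ.- b) ℚ.* (u ℚ.* v)
    expand = sym (trans
      (solve 4 (λ a b u v → (a :- b) :* (u :* v) := (a :* u) :* v :- (b :* v) :* u) refl a b u v)
      (cong₂ ℚ._-_ (trans (cong (ℚ._* v) au≡1) (ℚₚ.*-identityˡ v))
                   (trans (cong (ℚ._* u) bv≡1) (ℚₚ.*-identityˡ u))))
    eq : ℚ.∣ u ℚ.- v ∣ ≡ ℚ.∣ a ℚ.- b ∣ ℚ.* (u ℚ.* v)
    eq = trans (∣-∣-swap u v) (trans (cong ℚ.∣_∣ expand)
      (trans (ℚₚ.∣p*q∣≡∣p∣*∣q∣ (a ℚ.- b) (u ℚ.* v))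
        (cong (ℚ.∣ a ℚ.- b ∣ ℚ.*_) (ℚₚ.0≤p⇒∣p∣≡p (ℚₚ.<⇒≤ 0<uv)))))

infixl 7 _÷ʳ_

_÷ʳ_ : ∀ {z} → ℝ → 0ʳ <ʳ z → ℝ
x ÷ʳ 0<z = x *ʳ (1/ʳ 0<z)

<⇒0<- : ∀ x y → x <ʳ y → 0ʳ <ʳ y -ʳ x
<⇒0<- x y (apart δ 0<δ N x+δ≤y) = apart δ 0<δ N λ n N≤n →
  subst (ℚ._≤ seq y n ℚ.- seq x n)
    (solve 2 (λ a d → (a :+ d) :- a := con 0ℚ :+ d) refl (seq x n) δ)
    (ℚₚ.+-monoˡ-≤ (ℚ.- seq x n) (x+δ≤y n N≤n))
  where open +-*-Solver

0<-+ : ∀ x y → 0ʳ <ʳ x → 0ʳ <ʳ y → 0ʳ <ʳ x +ʳ y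
0<-+ x y (apart δ 0<δ M δ≤x) (apart η 0<η N η≤y) =
  apart (δ ℚ.+ η) (ℚₚ.+-mono-< 0<δ 0<η) (M ⊔ N) λ n n≥ →
    subst (ℚ._≤ seq x n ℚ.+ seq y n)
      (solve 2 (λ d e → (con 0ℚ :+ d) :+ (con 0ℚ :+ e) := con 0ℚ :+ (d :+ e)) refl δ η)
      (ℚₚ.+-mono-≤ (δ≤x n (⊔-left n≥)) (η≤y n (⊔-right {M} n≥)))
  where open +-*-Solver

0<-* : ∀ x y → 0ʳ <ʳ x → 0ʳ <ʳ y → 0ʳ <ʳ x *ʳ y
0<-* x y (apart δ 0<δ M δ≤x) (apart η 0<η N η≤y) =
  apart (δ ℚ.* η) (pos-* 0<δ 0<η) (M ⊔ N) λ n n≥ →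
    let δ≤xn = subst (ℚ._≤ seq x n) (ℚₚ.+-identityˡ δ) (δ≤x n (⊔-left n≥))
        η≤yn = subst (ℚ._≤ seq y n) (ℚₚ.+-identityˡ η) (η≤y n (⊔-right {M} n≥))
    in subst (ℚ._≤ seq x n ℚ.* seq y n) (sym (ℚₚ.+-identityˡ (δ ℚ.* η)))
         (*-mono (ℚₚ.≤-trans (ℚₚ.<⇒≤ 0<δ) δ≤xn) (ℚₚ.<⇒≤ 0<η) δ≤xn η≤yn)

0<-trans : ∀ x y → 0ʳ <ʳ x → x <ʳ y → 0ʳ <ʳ y
0<-trans x y (apart δ 0<δ M δ≤x) (apart η 0<η N x+η≤y) =
  apart δ 0<δ (M ⊔ N) λ n n≥ →
    ℚₚ.≤-trans (δ≤x n (⊔-left n≥))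
      (ℚₚ.≤-trans (subst (ℚ._≤ seq x n ℚ.+ η) (ℚₚ.+-identityʳ (seq x n))
                    (ℚₚ.+-monoʳ-≤ (seq x n) (ℚₚ.<⇒≤ 0<η)))
                  (x+η≤y n (⊔-right {M} n≥)))

0<1 : 0ʳ <ʳ 1ʳ
0<1 = apart 1ℚ (ℚₚ.positive⁻¹ 1ℚ) 0 λ _ _ → ℚₚ.≤-refl {1ℚ}

≤-<-trans : ∀ x y z → x ≤ʳ y → y <ʳ z → x <ʳ z
≤-<-trans x y z x≤y (apart δ 0<δ N y+δ≤z) =
  let M , x≤y+½δ = x≤y _ (halve 0<δ) in
  apart (½ ℚ.* δ) (halve 0<δ) (M ⊔ N) λ n n≥ →
    ℚₚ.≤-trans (ℚₚ.+-monoˡ-≤ (½ ℚ.* δ) (x≤y+½δ n (⊔-left n≥)))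
      (subst (ℚ._≤ seq z n)
        (trans (cong (seq y n ℚ.+_) (sym (halves δ))) (sym (ℚₚ.+-assoc (seq y n) _ _)))
        (y+δ≤z n (⊔-right {M} n≥)))

_⁺ _⁻ : ℤ → ℕ
(+ p)    ⁺ = p
-[1+ p ] ⁺ = 0
(+ p)    ⁻ = 0
-[1+ p ] ⁻ = suc p

infix 4 _≤_·_^ℚ_ _≤_·_^_+_ _∈Õ[_·_^_+_] _∈Õ[_^_] _∈O[_^_]

-- x ≤ A · b^q for rational q = u/d and b ≥ 1, in the form xᵈ ≤ Aᵈ · bᵘ.
_≤_·_^ℚ_ : ℕ → ℕ → ℕ → ℚ → Set
x ≤ A · b ^ℚ q = x ^ (↧ₙ q) * b ^ ((↥ q) ⁻) ≤ A ^ (↧ₙ q) * b ^ ((↥ q) ⁺)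

-- x ≤ A · b^r + B for real r and b ≥ 1, where b^r is the infimum of b^q over
-- the rationals q > r.
_≤_·_^_+_ : ℕ → ℕ → ℕ → ℝ → ℕ → Set
x ≤ A · b ^ r + B = ∀ q → r <ʳ ℚ⇒ℝ q → (x ∸ B) ≤ A · b ^ℚ q

bits : ℕ → ℕ
bits n = suc ⌊log₂ n ⌋

-- f ∈ Õ(t · b^r + s), uniformly over all x : X.  There is no exception for
-- small values of b: a condition only for large b would leave f unrestricted
-- on the infinitely many instances whose parameter is small.  To make this
-- satisfiable the base is read as max(b, 1).  The hidden factor is
-- polylogarithmic in the quantities t, b and s.
_∈Õ[_·_^_+_] : {X : Set} → (X → ℕ) → (X → ℕ) → (X → ℕ) → ℝ → (X → ℕ) → Set
f ∈Õ[ t · b ^ r + s ] = ∃₂ λ C k → ∀ x →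
  let polylog = bits (t x * (b x ⊔ 1) + s x) ^ k in
  f x ≤ C * polylog * t x · (b x ⊔ 1) ^ r + (C * polylog * s x)

_∈Õ[_^_] : {X : Set} → (X → ℕ) → (X → ℕ) → ℝ → Set
f ∈Õ[ b ^ r ] = f ∈Õ[ const 1 · b ^ r + const 0 ]

_∈O[_^_] : {X : Set} → (X → ℕ) → (X → ℕ) → ℝ → Set
f ∈O[ b ^ r ] = ∃ λ C → ∀ x → f x ≤ C · (b x ⊔ 1) ^ r + 0

-- The machine is a random access machine under logarithmic cost.  Its storage
-- consists of registers holding natural numbers and of resizable arrays of
-- natural numbers.  A program mentions only finitely many of either.
-- Every step is charged the number of bits it handles, which differs from the
-- word RAM by polylogarithmic factors.

data Op : Set where
  add sub mul div : Op

⟦_⟧ : Op → ℕ → ℕ → ℕ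
⟦ add ⟧ m n       = m + n
⟦ sub ⟧ m n       = m ∸ n
⟦ mul ⟧ m n       = m * n
⟦ div ⟧ m zero    = 0
⟦ div ⟧ m (suc n) = m / suc n

Reg Arr : Set
Reg = ℕ
Arr = ℕ

data Instr : Set where
  set   : Reg → ℕ → Instr                 -- x := k
  arith : Op → Reg → Reg → Reg → Instr    -- x := y ∘ z
  load  : Reg → Arr → Reg → Instr         -- x := A[y]
  store : Arr → Reg → Reg → Instr         -- A[x] := y
  push  : Arr → Reg → Instr               -- append x to A
  len   : Reg → Arr → Instr               -- x := |A|

infixr 5 _⨾_

data Program : Set where
  instr     : Instr → Program
  _⨾_       : Program → Program → Program
  ifNonzero : Reg → Program → Program → Program
  while     : Reg → Program → Program

record State : Set where
  constructor ⟨_,_⟩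
  field
    reg : Reg → ℕ
    arr : Arr → List ℕ

open State public

_[_≔_] : {A : Set} → (ℕ → A) → ℕ → A → ℕ → A
(f [ i ≔ v ]) j = if i ≡ᵇ j then v else f j

-- Reading outside an array gives 0, writing outside it has no effect.

read : List ℕ → ℕ → ℕ
read []       _       = 0
read (v ∷ vs) zero    = v
read (v ∷ vs) (suc i) = read vs i

write : List ℕ → ℕ → ℕ → List ℕ
write []       _       _ = []
write (v ∷ vs) zero    w = w ∷ vs
write (v ∷ vs) (suc i) w = v ∷ write vs i w

exec : Instr → State → State
exec (set x k)       ⟨ ρ , a ⟩ = ⟨ ρ [ x ≔ k ] , a ⟩
exec (arith o x y z) ⟨ ρ , a ⟩ = ⟨ ρ [ x ≔ ⟦ o ⟧ (ρ y) (ρ z) ] , a ⟩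
exec (load x A y)    ⟨ ρ , a ⟩ = ⟨ ρ [ x ≔ read (a A) (ρ y) ] , a ⟩
exec (store A x y)   ⟨ ρ , a ⟩ = ⟨ ρ , a [ A ≔ write (a A) (ρ x) (ρ y) ] ⟩
exec (push A x)      ⟨ ρ , a ⟩ = ⟨ ρ , a [ A ≔ a A ∷ʳ ρ x ] ⟩
exec (len x A)       ⟨ ρ , a ⟩ = ⟨ ρ [ x ≔ length (a A) ] , a ⟩

cost : Instr → State → ℕ
cost (set x k)       ⟨ ρ , a ⟩ = bits k
cost (arith o x y z) ⟨ ρ , a ⟩ = bits (ρ y) + bits (ρ z)
cost (load x A y)    ⟨ ρ , a ⟩ = bits (ρ y) + bits (read (a A) (ρ y))
cost (store A x y)   ⟨ ρ , a ⟩ = bits (ρ x) + bits (ρ y)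
cost (push A x)      ⟨ ρ , a ⟩ = bits (ρ x)
cost (len x A)       ⟨ ρ , a ⟩ = bits (length (a A))

-- p ⊢ s ⇓ s′ in[ t ]: started in state s, program p halts in state s′ after
-- time t.

infix 3 _⊢_⇓_in[_]

data _⊢_⇓_in[_] : Program → State → State → ℕ → Set where

  instr : ∀ {i s} → instr i ⊢ s ⇓ exec i s in[ cost i s ]

  _⨾_ : ∀ {p q s s′ s″ t u} →
        p ⊢ s ⇓ s′ in[ t ] → q ⊢ s′ ⇓ s″ in[ u ] →
        p ⨾ q ⊢ s ⇓ s″ in[ t + u ]

  ifZero : ∀ {x p q s s′ t} → reg s x ≡ 0 →
           q ⊢ s ⇓ s′ in[ t ] →
           ifNonzero x p q ⊢ s ⇓ s′ in[ bits (reg s x) + t ]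

  ifSuc : ∀ {x p q s s′ t n} → reg s x ≡ suc n →
          p ⊢ s ⇓ s′ in[ t ] →
          ifNonzero x p q ⊢ s ⇓ s′ in[ bits (reg s x) + t ]

  stop : ∀ {x p s} → reg s x ≡ 0 →
         while x p ⊢ s ⇓ s in[ bits (reg s x) ]

  loop : ∀ {x p s s′ s″ t u n} → reg s x ≡ suc n →
         p ⊢ s ⇓ s′ in[ t ] → while x p ⊢ s′ ⇓ s″ in[ u ] →
         while x p ⊢ s ⇓ s″ in[ bits (reg s x) + t + u ]

-- The input is in array 0, the output is left in array 1.  All other storage
-- is initially zero or empty.

initial : List ℕ → State
initial input = ⟨ const 0 , const [] [ 0 ≔ input ] ⟩

record Algorithm {A B : Set} (encodeᴬ : A → List ℕ) (encodeᴮ : B → List ℕ) : Set where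
  field
    program : Program
    result  : A → B
    time    : A → ℕ
    runs    : ∀ a → ∃ λ s → program ⊢ initial (encodeᴬ a) ⇓ s in[ time a ] ×
                            arr s 1 ≡ encodeᴮ (result a)

open Algorithm public

Word : ℕ → Set
Word σ = List (Fin σ)

Instance₁ Instance₂ : ℕ → Set
Instance₁ σ = Word σ × ℕ
Instance₂ σ = Word σ × (ℕ × ℕ)

Problem₁ Problem₂ : ℕ → Set₁
Problem₁ σ = Instance₁ σ → Set
Problem₂ σ = Instance₂ σ → Set

module _ {σ : ℕ} where

  param : Instance₁ σ → ℕ
  param (I , n) = n

  paramⁿ paramˡ : Instance₂ σ → ℕ
  paramⁿ (I , (n , ℓ)) = n
  paramˡ (I , (n , ℓ)) = ℓ

  maxParam : List (Instance₁ σ) → ℕ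
  maxParam xs = foldr _⊔_ 0 (map param xs)

  totalLength : List (Instance₁ σ) → ℕ
  totalLength xs = sum (map (λ x → length (proj₁ x)) xs)

  encode₁ : Instance₁ σ → List ℕ
  encode₁ (I , n) = n ∷ map toℕ I

  encode₂ : Instance₂ σ → List ℕ
  encode₂ (I , (n , ℓ)) = n ∷ ℓ ∷ map toℕ I

  encodeList : List (Instance₁ σ) → List ℕ
  encodeList = concatMap (λ { (I , n) → n ∷ length I ∷ map toℕ I })

encodeBool : Bool → List ℕ
encodeBool true  = 1 ∷ []
encodeBool false = 0 ∷ []

Decides : {A : Set} {encode : A → List ℕ} → Algorithm encode encodeBool → (A → Set) → Set
Decides alg P = ∀ x → P x ⇔ result alg x ≡ true

-- The size |I| + p of an instance whose parameter p is a pair depends on how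
-- the pair is read as a number, for instance as n + ℓ or as max(n, ℓ).  The
-- function ∥_∥ is that reading.
size : ∀ {σ} → (ℕ × ℕ → ℕ) → Instance₂ σ → ℕ
size ∥_∥ (I , p) = length I + ∥ p ∥

record Kernel {σ} (∥_∥ : ℕ × ℕ → ℕ) (Q : Problem₂ σ) (β γ : ℝ) : Set where
  field
    algorithm  : Algorithm (encode₂ {σ}) (encode₂ {σ})
    equivalent : ∀ x → Q x ⇔ Q (result algorithm x)
    time-bound : time algorithm ∈Õ[ paramⁿ ^ γ ]
    size-bound : (λ x → size ∥_∥ (result algorithm x)) ∈Õ[ paramˡ ^ β ]

-- The decomposition for one fixed real λ; α′ may depend on λ.  The list of
-- computed instances may be empty.  Bounding the maximum of the nᵢ makes the
-- bound on them uniform in i.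
record ORDecompositionAt {σ} (P : Problem₁ σ) (α : ℝ) (0<α : 0ʳ <ʳ α)
                         (lam : ℝ) (0<lam : 0ʳ <ʳ lam) : Set where
  0<α+lam : 0ʳ <ʳ α +ʳ lam
  0<α+lam = 0<-+ α lam 0<α 0<lam

  field
    algorithm   : Algorithm (encode₁ {σ}) (encodeList {σ})
    α′          : ℝ
    α′<α        : α′ <ʳ α
    time-bound  : time algorithm ∈Õ[ param ^ α′ ]
    count-bound : (λ x → length (result algorithm x)) ∈Õ[ param ^ α *ʳ lam ÷ʳ 0<α+lam ]
    equivalent  : ∀ x → P x ⇔ Any P (result algorithm x)
    param-bound : (λ x → maxParam (result algorithm x)) ∈Õ[ param ^ α ÷ʳ 0<α+lam ]

ORDecomposable : ∀ {σ} → Problem₁ σ → (α : ℝ) → 1ʳ <ʳ α → Set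
ORDecomposable P α 1<α =
  ∀ lam (0<lam : 0ʳ <ʳ lam) → ORDecompositionAt P α (0<-trans 1ʳ α 0<1 1<α) lam 0<lam

module _ {σ : ℕ} where

  count nₘₐₓ ∑∣I∣ : List⁺ (Instance₁ σ) → ℕ
  count xs = length (toList xs)
  nₘₐₓ  xs = maxParam (toList xs)
  ∑∣I∣  xs = totalLength (toList xs)

record ORCrossComposition {σ} (P : Problem₁ σ) (Q : Problem₂ σ) (ν μ : ℝ) : Set where
  field
    algorithm  : Algorithm (λ xs → encodeList {σ} (toList xs)) (encode₂ {σ})
    time-bound : time algorithm ∈Õ[ count · nₘₐₓ ^ ν + ∑∣I∣ ]
    equivalent : ∀ xs → Q (result algorithm xs) ⇔ Any P (toList xs)
    n-bound    : (λ xs → paramⁿ (result algorithm xs)) ∈Õ[ count · nₘₐₓ ^ ν + const 0 ]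
    ℓ-bound    : (λ xs → paramˡ (result algorithm xs)) ∈Õ[ nₘₐₓ ^ μ ]

{-# OPTIONS --safe #-}
-- An instance of P is decomposed with parameter λ, its parts are composed into one instance of Q,
-- and the kernel of that instance is decided.  The exponents of the running times of the
-- composition, the kernel and the decision are x (λ + ν), x (λ + ν) γ and x β μ ξ, where
-- x = α / (α + λ).  All of them are below α if (λ + ν) γ < α + λ and β μ ξ < α + λ, and the
-- bound on β says that some λ > 0 satisfies both.
--
-- All exponents are then replaced by slightly larger rationals, which absorbs the polylogarithmic
-- factors and leaves only inequalities between powers of natural numbers.
module Submission where

open import Defs
open import Data.Bool using (true; false; T)
open import Data.Empty using (⊥-elim)
open import Data.Fin using (toℕ)
open import Data.Integer as ℤ using (-[1+_])
import Data.Integer.Properties as ℤₚ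
open import Data.List using (List; []; _∷_; _∷ʳ_; _++_; map; length)
open import Data.List.NonEmpty as List⁺ using (List⁺; toList)
open import Data.List.Properties using (length-++; length-map)
open import Data.List.Relation.Unary.Any using (Any)
open import Data.Nat as ℕ
  using (ℕ; zero; suc; _+_; _*_; _∸_; _^_; _≤_; _<_; _⊔_; _≡ᵇ_; NonZero; s≤s; z≤n; ⌊_/2⌋)
open import Data.Nat.DivMod using (_/_; _%_; m≡m%n+[m/n]*n; m%n<n)
open import Data.Nat.Induction using (<-rec)
open import Data.Nat.Logarithm using (⌊log₂_⌋; ⌊log₂⌊n/2⌋⌋≡⌊log₂n⌋∸1)
open import Data.Nat.Properties hiding (≤-<-trans)
open import Data.Product using (∃; _×_; _,_; proj₁)
open import Data.Rational as ℚ using (ℚ; 0ℚ; 1ℚ; ½; ↥_; ↧ₙ_; mkℚ)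
import Data.Rational.Properties as ℚₚ
open import Data.Rational.Solver using (module +-*-Solver)
import Data.Rational.Unnormalised as ℚᵘ
import Data.Rational.Unnormalised.Properties as ℚᵘₚ
open import Data.Sum using (_⊎_; inj₁; inj₂)
open import Function using (_∘_; id; const)
open import Function.Bundles using (mk⇔)
open import Function.Construct.Composition using (_⇔-∘_)
open import Function.Construct.Symmetry using (⇔-sym)
open import Relation.Binary.PropositionalEquality
open import Relation.Nullary using (yes; no)
open +-*-Solver using (solve; _:=_; _:+_; _:*_; _:-_; con)

-- The decomposition yields about n^(x λ) parts with parameter about n^x, so the composed instance
-- has n_Q about n^(x λ + x ν) and ℓ about n^(x μ). Since x (α + λ) = α, an exponent x y is below α
-- exactly if y < α + λ, which is the form of both conditions on λ. Three obstacles shape the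
-- argument. A program presumes fresh storage, so stages sharing one machine are kept apart by
-- renaming. The composition also pays for the lengths of the parts, on which the decomposition
-- imposes no explicit bound; they are at most the decomposition time, because every output entry
-- has to be written. Finally, only nonempty lists can be composed: an empty decomposition is
-- answered separately, and the time bounds of the later stages hold on a subset of the inputs until
-- they are extended.

infix 4 _≼_^_ _≈ʳ_
infixr 5 _⨾ᴬ_


-- Composition of algorithms

≡ᵇ-refl : ∀ n → (n ≡ᵇ n) ≡ true
≡ᵇ-refl zero    = refl
≡ᵇ-refl (suc n) = ≡ᵇ-refl n

≢⇒≡ᵇ-false : ∀ {m n} → m ≢ n → (m ≡ᵇ n) ≡ false
≢⇒≡ᵇ-false {m} {n} m≢n with m ≡ᵇ n in eq
... | false = refl
... | true  = ⊥-elim (m≢n (≡ᵇ⇒≡ m n (subst T (sym eq) _)))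

Injective : (ℕ → ℕ) → Set
Injective f = ∀ {m n} → f m ≡ f n → m ≡ n

≡ᵇ-injective : ∀ {f} → Injective f → ∀ m n → (f m ≡ᵇ f n) ≡ (m ≡ᵇ n)
≡ᵇ-injective {f} inj m n with m ≟ n
... | yes refl = trans (≡ᵇ-refl (f m)) (sym (≡ᵇ-refl m))
... | no m≢n   = trans (≢⇒≡ᵇ-false (m≢n ∘ inj)) (sym (≢⇒≡ᵇ-false m≢n))

Outside : (ℕ → ℕ) → ℕ → Set
Outside f j = ∀ i → f i ≢ j

update-outside : {A : Set} (h : ℕ → A) (f : ℕ → ℕ) (i : ℕ) (v : A) {j : ℕ} →
                 Outside f j → (h [ f i ≔ v ]) j ≡ h j
update-outside h f i v {j} j∉f rewrite ≢⇒≡ᵇ-false (j∉f i) = refl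

update-rename : {A : Set} {f : ℕ → ℕ} → Injective f → (h h′ : ℕ → A) →
                (∀ j → h′ (f j) ≡ h j) → (i : ℕ) {v v′ : A} → v′ ≡ v →
                ∀ j → (h′ [ f i ≔ v′ ]) (f j) ≡ (h [ i ≔ v ]) j
update-rename {f = f} inj h h′ agree i refl j
  rewrite ≡ᵇ-injective {f} inj i j with i ≡ᵇ j
... | true  = refl
... | false = agree j

retime : ∀ {p s s′ t u} → t ≡ u → p ⊢ s ⇓ s′ in[ t ] → p ⊢ s ⇓ s′ in[ u ]
retime refl r = r

-- Chained programs share one storage; renaming registers by `f` and arrays by `g` gives each its
-- own share.
module Renaming (f g : ℕ → ℕ) where

  renameInstr : Instr → Instr
  renameInstr (set x k)       = set (f x) k
  renameInstr (arith o x y z) = arith o (f x) (f y) (f z)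
  renameInstr (load x A y)    = load (f x) (g A) (f y)
  renameInstr (store A x y)   = store (g A) (f x) (f y)
  renameInstr (push A x)      = push (g A) (f x)
  renameInstr (len x A)       = len (f x) (g A)

  rename : Program → Program
  rename (instr i)         = instr (renameInstr i)
  rename (p ⨾ q)           = rename p ⨾ rename q
  rename (ifNonzero x p q) = ifNonzero (f x) (rename p) (rename q)
  rename (while x p)       = while (f x) (rename p)

  record Simulates (σ s : State) : Set where
    constructor simulates
    field
      regs : ∀ r → reg σ (f r) ≡ reg s r
      arrs : ∀ a → arr σ (g a) ≡ arr s a

  -- A program that runs later expects zero registers and empty arrays; this says that an earlier
  -- one has left that share untouched.
  record Frame (σ σ′ : State) : Set where
    constructor frame
    field
      regs : ∀ {r} → Outside f r → reg σ′ r ≡ reg σ r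
      arrs : ∀ {a} → Outside g a → arr σ′ a ≡ arr σ a

  open Simulates
  open Frame

  frame-refl : ∀ {σ} → Frame σ σ
  frame-refl = frame (λ _ → refl) (λ _ → refl)

  frame-trans : ∀ {σ σ′ σ″} → Frame σ σ′ → Frame σ′ σ″ → Frame σ σ″
  frame-trans F G = frame (λ o → trans (regs G o) (regs F o)) (λ o → trans (arrs G o) (arrs F o))

  exec-frame : ∀ i σ → Frame σ (exec (renameInstr i) σ)
  exec-frame (set x k)       σ = frame (update-outside (reg σ) f x _) (λ _ → refl)
  exec-frame (arith o x y z) σ = frame (update-outside (reg σ) f x _) (λ _ → refl)
  exec-frame (load x A y)    σ = frame (update-outside (reg σ) f x _) (λ _ → refl)
  exec-frame (store A x y)   σ = frame (λ _ → refl) (update-outside (arr σ) g A _)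
  exec-frame (push A x)      σ = frame (λ _ → refl) (update-outside (arr σ) g A _)
  exec-frame (len x A)       σ = frame (update-outside (reg σ) f x _) (λ _ → refl)

  cost-rename : ∀ i {σ s} → Simulates σ s → cost (renameInstr i) σ ≡ cost i s
  cost-rename (set x k)       S = refl
  cost-rename (arith o x y z) S = cong₂ (λ m n → bits m + bits n) (regs S y) (regs S z)
  cost-rename (load x A y)    S = cong₂ (λ i vs → bits i + bits (read vs i)) (regs S y) (arrs S A)
  cost-rename (store A x y)   S = cong₂ (λ m n → bits m + bits n) (regs S x) (regs S y)
  cost-rename (push A x)      S = cong bits (regs S x)
  cost-rename (len x A)       S = cong (bits ∘ length) (arrs S A)

  module _ (f-injective : Injective f) (g-injective : Injective g) where

    exec-rename : ∀ i {σ s} → Simulates σ s → Simulates (exec (renameInstr i) σ) (exec i s)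
    exec-rename (set x k) {σ} {s} S = simulates
      (update-rename f-injective (reg s) (reg σ) (regs S) x refl) (arrs S)
    exec-rename (arith o x y z) {σ} {s} S = simulates
      (update-rename f-injective (reg s) (reg σ) (regs S) x
        (cong₂ ⟦ o ⟧ (regs S y) (regs S z)))
      (arrs S)
    exec-rename (load x A y) {σ} {s} S = simulates
      (update-rename f-injective (reg s) (reg σ) (regs S) x
        (cong₂ read (arrs S A) (regs S y)))
      (arrs S)
    exec-rename (store A x y) {σ} {s} S = simulates (regs S)
      (update-rename g-injective (arr s) (arr σ) (arrs S) A
        (trans (cong (λ vs → write vs (reg σ (f x)) (reg σ (f y))) (arrs S A))
               (cong₂ (write (arr s A)) (regs S x) (regs S y))))
    exec-rename (push A x) {σ} {s} S = simulates (regs S)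
      (update-rename g-injective (arr s) (arr σ) (arrs S) A (cong₂ _∷ʳ_ (arrs S A) (regs S x)))
    exec-rename (len x A) {σ} {s} S = simulates
      (update-rename f-injective (reg s) (reg σ) (regs S) x (cong length (arrs S A))) (arrs S)

    -- Costs depend on the stored values and not on the names of registers or arrays, so the time is
    -- preserved exactly.
    rename-run : ∀ {p s s′ t σ} → p ⊢ s ⇓ s′ in[ t ] → Simulates σ s →
                 ∃ λ σ′ → rename p ⊢ σ ⇓ σ′ in[ t ] × Simulates σ′ s′ × Frame σ σ′
    rename-run {σ = σ} (instr {i = i}) S =
      _ , retime (cost-rename i S) instr , exec-rename i S , exec-frame i σ
    rename-run (r ⨾ r′) S =
      let _ , run  , S′ , F  = rename-run r S
          _ , run′ , S″ , F′ = rename-run r′ S′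
      in _ , run ⨾ run′ , S″ , frame-trans F F′
    rename-run (ifZero {x = x} {t = t} x≡0 r) S =
      let _ , run , S′ , F = rename-run r S in
      _ , retime (cong (λ n → bits n + t) (regs S x)) (ifZero (trans (regs S x) x≡0) run) , S′ , F
    rename-run (ifSuc {x = x} {t = t} x≡suc r) S =
      let _ , run , S′ , F = rename-run r S in
      _ , retime (cong (λ n → bits n + t) (regs S x)) (ifSuc (trans (regs S x) x≡suc) run) , S′ , F
    rename-run (stop {x = x} x≡0) S =
      _ , retime (cong bits (regs S x)) (stop (trans (regs S x) x≡0)) , S , frame-refl
    rename-run (loop {x = x} {t = t} {u = u} x≡suc r r′) S =
      let _ , run  , S′ , F  = rename-run r S
          _ , run′ , S″ , F′ = rename-run r′ S′
      in _ , retime (cong (λ n → bits n + t + u) (regs S x))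
               (loop (trans (regs S x) x≡suc) run run′) ,
         S″ , frame-trans F F′

open Renaming

double : ℕ → ℕ
double n = 2 * n

odd : ℕ → ℕ
odd n = suc (double n)

double-injective : Injective double
double-injective = *-cancelˡ-≡ _ _ 2

odd-injective : Injective odd
odd-injective = double-injective ∘ suc-injective

double≢odd : ∀ m n → double m ≢ odd n
double≢odd m n = even≢odd m n

-- Array 2 is the output of the first program and the input of the second one.
second : ℕ → ℕ
second zero    = 2
second (suc a) = odd a

second-injective : Injective second
second-injective {zero}  {zero}  _  = refl
second-injective {zero}  {suc n} eq = ⊥-elim (double≢odd 1 n eq)
second-injective {suc m} {zero}  eq = ⊥-elim (double≢odd 1 m (sym eq))
second-injective {suc m} {suc n} eq = cong suc (odd-injective eq)

-- `double 0` is 0 and `second 1` is 1, so the outer input and output arrays stay where the machine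
-- expects them, and nothing has to be copied.
_⨾ᴬ_ : {A B C : Set} {eᴬ : A → List ℕ} {eᴮ : B → List ℕ} {eᶜ : C → List ℕ} →
       Algorithm eᴬ eᴮ → Algorithm eᴮ eᶜ → Algorithm eᴬ eᶜ
_⨾ᴬ_ {eᴬ = eᴬ} {eᴮ} {eᶜ} 𝒜 ℬ = record
  { program = rename double double (program 𝒜) ⨾ rename odd second (program ℬ)
  ; result  = result ℬ ∘ result 𝒜
  ; time    = λ a → time 𝒜 a + time ℬ (result 𝒜 a)
  ; runs    = λ a →
      let b = result 𝒜 a
          s , run , out = runs 𝒜 a
          s′ , run′ , out′ = runs ℬ b
          σ , ren , simulates rs as , frame rf af =
            rename-run double double double-injective double-injective run (start a)
          σ′ , ren′ , S′ , _ =
            rename-run odd second odd-injective second-injective run′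
              -- Odd registers and arrays lie outside the image of `double` and are still fresh;
              -- array 2 is `double 1`, the output of `𝒜`.
              (simulates (λ r → rf (λ i → double≢odd i r)) λ
                { zero    → trans (as 1) out
                ; (suc j) → af (λ i → double≢odd i j) })
      in σ′ , ren ⨾ ren′ , trans (Renaming.Simulates.arrs S′ 1) out′
  }
  where
  start : ∀ a → Simulates double double (initial (eᴬ a)) (initial (eᴬ a))
  start a = simulates (λ _ → refl) λ { zero → refl ; (suc j) → refl }

-- Each encoded instance has at least two entries, so array 0 is empty exactly for the empty list.
-- Register 0 holds its length, hence the shift of registers by `suc`; in the empty case it is 0,
-- which `push` writes as the code of `false`.
decideEmpty : ∀ {σ} → Algorithm (λ xs → encodeList {σ} (toList xs)) encodeBool →
              Algorithm (encodeList {σ}) encodeBool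
decideEmpty 𝒜 = record
  { program = instr (len 0 0) ⨾ ifNonzero 0 (rename suc id (program 𝒜)) (instr (push 1 0))
  ; result  = λ { [] → false ; (x ∷ xs) → result 𝒜 (x List⁺.∷ xs) }
  ; time    = λ where
      []       → bits 0 + (bits 0 + bits 0)
      (x ∷ xs) → let b = bits (length (encodeList (x ∷ xs))) in b + (b + time 𝒜 (x List⁺.∷ xs))
  ; runs    = λ where
      [] → _ , instr ⨾ ifZero refl instr , refl
      (x ∷ xs) →
        let s , run , out = runs 𝒜 (x List⁺.∷ xs)
            σ , ren , S , _ = rename-run suc id suc-injective id run
              (simulates {σ = exec (len 0 0) (initial (encodeList (x ∷ xs)))}
                (λ _ → refl) (λ _ → refl))
        in σ , instr ⨾ ifSuc refl ren , trans (Renaming.Simulates.arrs S 1) out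
  }

-- Output length and running time

length-write : ∀ vs i w → length (write vs i w) ≡ length vs
length-write []       i       w = refl
length-write (v ∷ vs) zero    w = refl
length-write (v ∷ vs) (suc i) w = cong suc (length-write vs i w)

update-length : (h : Arr → List ℕ) (A : Arr) {vs : List ℕ} {c : ℕ} →
                length vs ≤ length (h A) + c → ∀ B → length ((h [ A ≔ vs ]) B) ≤ length (h B) + c
update-length h A le B with A ≡ᵇ B in eq
... | false = m≤m+n _ _
... | true rewrite ≡ᵇ⇒≡ A B (subst T (sym eq) _) = le

-- Only `push` lengthens an array, by one entry, and `bits` is at least 1.
exec-length : ∀ i s A → length (arr (exec i s) A) ≤ length (arr s A) + cost i s
exec-length (set x k)       s A = m≤m+n _ _
exec-length (arith o x y z) s A = m≤m+n _ _
exec-length (load x B y)    s A = m≤m+n _ _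
exec-length (store B x y)   s A = update-length (arr s) B
  (≤-trans (≤-reflexive (length-write (arr s B) _ _)) (m≤m+n _ _)) A
exec-length (push B x)      s A = update-length (arr s) B
  (≤-trans (≤-reflexive (length-++ (arr s B))) (+-monoʳ-≤ _ (s≤s z≤n))) A
exec-length (len x B)       s A = m≤m+n _ _

run-length : ∀ {p s s′ t} → p ⊢ s ⇓ s′ in[ t ] → ∀ A → length (arr s′ A) ≤ length (arr s A) + t
run-length {s = s} (instr {i = i}) A = exec-length i s A
run-length {s = s} (_⨾_ {s′ = s′} {t = t} {u} r r′) A = begin
  _                              ≤⟨ run-length r′ A ⟩
  length (arr s′ A) + u          ≤⟨ +-monoˡ-≤ u (run-length r A) ⟩
  length (arr s A) + t + u       ≡⟨ +-assoc (length (arr s A)) t u ⟩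
  length (arr s A) + (t + u)     ∎
  where open ≤-Reasoning
run-length {s = s} (ifZero {t = t} _ r) A =
  ≤-trans (run-length r A) (+-monoʳ-≤ (length (arr s A)) (m≤n+m t _))
run-length {s = s} (ifSuc {t = t} _ r) A =
  ≤-trans (run-length r A) (+-monoʳ-≤ (length (arr s A)) (m≤n+m t _))
run-length (stop _)     A = m≤m+n _ _
run-length {s = s} (loop {s′ = s′} {t = t} {u = u} _ r r′) A = begin
  _                              ≤⟨ run-length r′ A ⟩
  length (arr s′ A) + u          ≤⟨ +-monoˡ-≤ u (run-length r A) ⟩
  length (arr s A) + t + u       ≡⟨ +-assoc (length (arr s A)) t u ⟩
  length (arr s A) + (t + u)     ≤⟨ +-monoʳ-≤ (length (arr s A)) (+-monoˡ-≤ u (m≤n+m t _)) ⟩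
  _                              ∎
  where open ≤-Reasoning

-- Array 1 starts empty. Applied to the decomposition, this bounds the total length of the parts.
output-length : {A B : Set} {eᴬ : A → List ℕ} {eᴮ : B → List ℕ} (𝒜 : Algorithm eᴬ eᴮ) →
                ∀ a → length (eᴮ (result 𝒜 a)) ≤ time 𝒜 a
output-length 𝒜 a = let s , run , out = runs 𝒜 a in
  subst (λ vs → length vs ≤ time 𝒜 a) out (run-length run 1)

totalLength≤encodeList : ∀ {σ} (xs : List (Instance₁ σ)) → totalLength xs ≤ length (encodeList xs)
totalLength≤encodeList []             = z≤n
totalLength≤encodeList ((I , n) ∷ xs) = begin
  length I + totalLength xs
    ≤⟨ +-mono-≤
         (≤-reflexive (sym (length-map toℕ I)))
         (totalLength≤encodeList xs) ⟩
  length (map toℕ I) + length (encodeList xs)    ≡⟨ length-++ (map toℕ I) ⟨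
  length (map toℕ I ++ encodeList xs)            ≤⟨ m≤n+m _ 2 ⟩
  length (encodeList ((I , n) ∷ xs))             ∎
  where open ≤-Reasoning

-- Real numbers

-- Eventual equality of the sequences suffices for all rewriting here: the clamp in `1/ʳ_` makes (x
-- / z) z agree with x only from some index on.
_≈ʳ_ : ℝ → ℝ → Set
x ≈ʳ y = ∃ λ N → ∀ n → N ≤ n → seq x n ≡ seq y n

<ʳ-resp-≈ʳ : ∀ {x x′ y y′} → x ≈ʳ x′ → y ≈ʳ y′ → x <ʳ y → x′ <ʳ y′
<ʳ-resp-≈ʳ (L , x≡) (M , y≡) (apart δ 0<δ N below) = apart δ 0<δ (L ⊔ M ⊔ N) λ n n≥ →
  subst₂ (λ u v → u ℚ.+ δ ℚ.≤ v) (x≡ n (⊔-left (⊔-left n≥))) (y≡ n (⊔-right {L} (⊔-left n≥)))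
    (below n (⊔-right {L ⊔ M} n≥))

<ʳ-respˡ : ∀ {x x′ y} → (∀ n → seq x n ≡ seq x′ n) → x <ʳ y → x′ <ʳ y
<ʳ-respˡ {x} {x′} {y} x≡ = <ʳ-resp-≈ʳ {x} {x′} {y} {y} (0 , λ n _ → x≡ n) (0 , λ _ _ → refl)

<ʳ-respʳ : ∀ {x y y′} → (∀ n → seq y n ≡ seq y′ n) → x <ʳ y → x <ʳ y′
<ʳ-respʳ {x} {y} {y′} y≡ = <ʳ-resp-≈ʳ {x} {x} {y} {y′} (0 , λ _ _ → refl) (0 , λ n _ → y≡ n)

p<q⇒0<q-p : ∀ {p q} → p ℚ.< q → 0ℚ ℚ.< q ℚ.- p
p<q⇒0<q-p {p} {q} p<q = subst (ℚ._< q ℚ.- p) (ℚₚ.+-inverseʳ p) (ℚₚ.+-monoˡ-< (ℚ.- p) p<q)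

ℚ-<⇒<ʳ : ∀ {p q} → p ℚ.< q → ℚ⇒ℝ p <ʳ ℚ⇒ℝ q
ℚ-<⇒<ʳ {p} {q} p<q = apart (q ℚ.- p) (p<q⇒0<q-p p<q) 0
  λ _ _ → ℚₚ.≤-reflexive (solve 2 (λ p q → p :+ (q :- p) := q) refl p q)

<ʳ⇒ℚ-< : ∀ {p q} → ℚ⇒ℝ p <ʳ ℚ⇒ℝ q → p ℚ.< q
<ʳ⇒ℚ-< {p} {q} (apart δ 0<δ N below) = ℚₚ.<-≤-trans
  (subst (ℚ._< p ℚ.+ δ) (ℚₚ.+-identityʳ p) (ℚₚ.+-monoʳ-< p 0<δ)) (below N ≤-refl)

<ʳ-trans : ∀ x y z → x <ʳ y → y <ʳ z → x <ʳ z
<ʳ-trans x y z (apart δ 0<δ M x+δ≤y) (apart η 0<η N y+η≤z) = apart δ 0<δ (M ⊔ N) λ n n≥ →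
  ℚₚ.≤-trans (x+δ≤y n (⊔-left n≥))
    (ℚₚ.≤-trans (subst (ℚ._≤ seq y n ℚ.+ η) (ℚₚ.+-identityʳ (seq y n))
                  (ℚₚ.+-monoʳ-≤ (seq y n) (ℚₚ.<⇒≤ 0<η)))
                (y+η≤z n (⊔-right {M} n≥)))

<ʳ-≤-trans : ∀ x {p q} → x <ʳ ℚ⇒ℝ p → p ℚ.≤ q → x <ʳ ℚ⇒ℝ q
<ʳ-≤-trans x (apart δ 0<δ N below) p≤q = apart δ 0<δ N λ n n≥ → ℚₚ.≤-trans (below n n≥) p≤q

⊔-elim : (P : ℚ → Set) → ∀ p q → P p → P q → P (p ℚ.⊔ q)
⊔-elim P p q Pp Pq with ℚₚ.⊔-sel p q
... | inj₁ eq = subst P (sym eq) Pp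
... | inj₂ eq = subst P (sym eq) Pq

⊓-elim : (P : ℚ → Set) → ∀ p q → P p → P q → P (p ℚ.⊓ q)
⊓-elim P p q Pp Pq with ℚₚ.⊓-sel p q
... | inj₁ eq = subst P (sym eq) Pp
... | inj₂ eq = subst P (sym eq) Pq

ℚ-+-cancelʳ-≤ : ∀ r p q → p ℚ.+ r ℚ.≤ q ℚ.+ r → p ℚ.≤ q
ℚ-+-cancelʳ-≤ r p q le = subst₂ ℚ._≤_ (cancel p) (cancel q) (ℚₚ.+-monoˡ-≤ (ℚ.- r) le)
  where
  cancel : ∀ p → p ℚ.+ r ℚ.- r ≡ p
  cancel p = solve 2 (λ p r → p :+ r :- r := p) refl p r

p≤∣p∣ : ∀ p → p ℚ.≤ ℚ.∣ p ∣
p≤∣p∣ p with ℚₚ.≤-total 0ℚ p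
... | inj₁ 0≤p = ℚₚ.≤-reflexive (sym (ℚₚ.0≤p⇒∣p∣≡p 0≤p))
... | inj₂ p≤0 = ℚₚ.≤-trans p≤0 (ℚₚ.0≤∣p∣ p)

∣p-q∣<ε⇒p≤q+ε : ∀ {p q ε} → ℚ.∣ p ℚ.- q ∣ ℚ.< ε → p ℚ.≤ q ℚ.+ ε
∣p-q∣<ε⇒p≤q+ε {p} {q} {ε} d<ε = subst (ℚ._≤ q ℚ.+ ε) (solve 2 (λ p q → q :+ (p :- q) := p) refl p q)
  (ℚₚ.+-monoʳ-≤ q (ℚₚ.≤-trans (p≤∣p∣ (p ℚ.- q)) (ℚₚ.<⇒≤ d<ε)))

-- With η = δ / 4, take a term of `y` from where `y` varies by less than η and lower it by 2 η. It
-- keeps a distance of η from both sides.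
<ʳ-dense : ∀ x y → x <ʳ y → ∃ λ q → x <ʳ ℚ⇒ℝ q × ℚ⇒ℝ q <ʳ y
<ʳ-dense x y (apart δ 0<δ N x+δ≤y) =
  let M , c = cauchy y η 0<η
      K = M ⊔ N
  in seq y K ℚ.- (η ℚ.+ η) ,
     (apart η 0<η K λ n n≥ → lower (seq x n) (seq y n) (seq y K)
       (subst (λ d → seq x n ℚ.+ d ℚ.≤ seq y n) (sym 4η≡δ) (x+δ≤y n (⊔-right {M} n≥)))
       (∣p-q∣<ε⇒p≤q+ε (c n K (⊔-left n≥) (m≤m⊔n M N)))) ,
     (apart η 0<η K λ n n≥ → upper (seq y n) (seq y K)
       (∣p-q∣<ε⇒p≤q+ε (c K n (m≤m⊔n M N) (⊔-left n≥))))
  where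
  open ℚₚ.≤-Reasoning
  η : ℚ
  η = ½ ℚ.* (½ ℚ.* δ)
  0<η : 0ℚ ℚ.< η
  0<η = halve (halve 0<δ)
  4η≡δ : (η ℚ.+ η) ℚ.+ (η ℚ.+ η) ≡ δ
  4η≡δ = trans (cong₂ ℚ._+_ (halves (½ ℚ.* δ)) (halves (½ ℚ.* δ))) (halves δ)
  lower : ∀ a b k → a ℚ.+ ((η ℚ.+ η) ℚ.+ (η ℚ.+ η)) ℚ.≤ b → b ℚ.≤ k ℚ.+ η →
          a ℚ.+ η ℚ.≤ k ℚ.- (η ℚ.+ η)
  lower a b k a+4η≤b b≤k+η = ℚ-+-cancelʳ-≤ (η ℚ.+ (η ℚ.+ η)) (a ℚ.+ η) (k ℚ.- (η ℚ.+ η)) (begin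
    a ℚ.+ η ℚ.+ (η ℚ.+ (η ℚ.+ η))
      ≡⟨ solve 2 (λ a e → a :+ e :+ (e :+ (e :+ e)) := a :+ ((e :+ e) :+ (e :+ e))) refl a η ⟩
    a ℚ.+ ((η ℚ.+ η) ℚ.+ (η ℚ.+ η))          ≤⟨ a+4η≤b ⟩
    b                                        ≤⟨ b≤k+η ⟩
    k ℚ.+ η
      ≡⟨ solve 2 (λ k e → k :+ e := k :- (e :+ e) :+ (e :+ (e :+ e))) refl k η ⟩
    k ℚ.- (η ℚ.+ η) ℚ.+ (η ℚ.+ (η ℚ.+ η))    ∎)
  upper : ∀ b k → k ℚ.≤ b ℚ.+ η → k ℚ.- (η ℚ.+ η) ℚ.+ η ℚ.≤ b
  upper b k k≤b+η = ℚ-+-cancelʳ-≤ η (k ℚ.- (η ℚ.+ η) ℚ.+ η) b (begin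
    k ℚ.- (η ℚ.+ η) ℚ.+ η ℚ.+ η
      ≡⟨ solve 2 (λ k e → k :- (e :+ e) :+ e :+ e := k) refl k η ⟩
    k                                        ≤⟨ k≤b+η ⟩
    b ℚ.+ η                                  ∎)

-- The order depends on termwise differences only, so moving terms across an inequality becomes a
-- ring identity in ℚ.
<ʳ-rearrange : ∀ x y x′ y′ → (∀ n → seq y n ℚ.- seq x n ≡ seq y′ n ℚ.- seq x′ n) →
               x <ʳ y → x′ <ʳ y′
<ʳ-rearrange x y x′ y′ y-x≡ (apart δ 0<δ N below) = apart δ 0<δ N λ n n≥ →
  shift (seq x n) (seq y n) (seq x′ n) (seq y′ n) (y-x≡ n) (below n n≥)
  where
  shift : ∀ a b c d → b ℚ.- a ≡ d ℚ.- c → a ℚ.+ δ ℚ.≤ b → c ℚ.+ δ ℚ.≤ d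
  shift a b c d eq a+δ≤b = subst₂ ℚ._≤_
    (solve 3 (λ a c δ → a :+ δ :+ (c :- a) := c :+ δ) refl a c δ)
    (trans (solve 3 (λ a b c → b :+ (c :- a) := b :- a :+ c) refl a b c)
      (trans (cong (ℚ._+ c) eq) (solve 2 (λ d c → d :- c :+ c := d) refl d c)))
    (ℚₚ.+-monoˡ-≤ (c ℚ.- a) a+δ≤b)

*-monoˡ-<ʳ : ∀ x y z → 0ʳ <ʳ z → x <ʳ y → x *ʳ z <ʳ y *ʳ z
*-monoˡ-<ʳ x y z 0<z x<y = <ʳ-rearrange 0ʳ ((y -ʳ x) *ʳ z) (x *ʳ z) (y *ʳ z)
  (λ n → solve 3 (λ a b c → (b :- a) :* c :- con 0ℚ := b :* c :- a :* c)
    refl (seq x n) (seq y n) (seq z n))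
  (0<-* (y -ʳ x) z (<⇒0<- x y x<y) 0<z)

-- The gap δ of the products, divided by z, is at least δ / B for an upper bound B on z.
*-cancelʳ-<ʳ : ∀ x y z → 0ʳ <ʳ z → x *ʳ z <ʳ y *ʳ z → x <ʳ y
*-cancelʳ-<ʳ x y z (apart η 0<η M η≤z) (apart δ 0<δ N below) =
  let B , L , 0<B , z≤B = bounded z in
  apart (δ ℚ.* (ℚ.1/ B) {{ℚ.>-nonZero 0<B}}) (pos-* 0<δ (pos-1/ 0<B)) (L ⊔ M ⊔ N) λ n n≥ →
    divide 0<B (seq x n) (seq y n)
      (ℚₚ.<-≤-trans 0<η (subst (ℚ._≤ seq z n) (ℚₚ.+-identityˡ η) (η≤z n (⊔-right {L} (⊔-left n≥)))))
      (ℚₚ.≤-trans (p≤∣p∣ (seq z n)) (z≤B n (⊔-left (⊔-left n≥))))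
      (below n (⊔-right {L ⊔ M} n≥))
  where
  divide : ∀ {B c} (0<B : 0ℚ ℚ.< B) a b → 0ℚ ℚ.< c → c ℚ.≤ B → a ℚ.* c ℚ.+ δ ℚ.≤ b ℚ.* c →
           a ℚ.+ δ ℚ.* (ℚ.1/ B) {{ℚ.>-nonZero 0<B}} ℚ.≤ b
  divide {B} {c} 0<B a b 0<c c≤B ac+δ≤bc = ℚₚ.*-cancelʳ-≤-pos c {{ℚ.positive 0<c}} (begin
    (a ℚ.+ δ ℚ.* 1/B) ℚ.* c
      ≡⟨ solve 4 (λ a d b c → (a :+ d :* b) :* c := a :* c :+ d :* (b :* c)) refl a δ 1/B c ⟩
    a ℚ.* c ℚ.+ δ ℚ.* (1/B ℚ.* c)
      ≤⟨ ℚₚ.+-monoʳ-≤ (a ℚ.* c) (ℚₚ.*-monoˡ-≤-nonNeg δ {{ℚ.nonNegative (ℚₚ.<⇒≤ 0<δ)}}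
           (ℚₚ.*-monoˡ-≤-nonNeg 1/B {{ℚ.nonNegative (ℚₚ.<⇒≤ (pos-1/ 0<B))}} c≤B)) ⟩
    a ℚ.* c ℚ.+ δ ℚ.* (1/B ℚ.* B)
      ≡⟨ cong (λ u → a ℚ.* c ℚ.+ δ ℚ.* u) (ℚₚ.*-inverseˡ B {{ℚ.>-nonZero 0<B}}) ⟩
    a ℚ.* c ℚ.+ δ ℚ.* 1ℚ               ≡⟨ cong (a ℚ.* c ℚ.+_) (ℚₚ.*-identityʳ δ) ⟩
    a ℚ.* c ℚ.+ δ                      ≤⟨ ac+δ≤bc ⟩
    b ℚ.* c                            ∎)
    where
    open ℚₚ.≤-Reasoning
    1/B : ℚ
    1/B = (ℚ.1/ B) {{ℚ.>-nonZero 0<B}}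

÷-*-cancel : ∀ x {z} (0<z : 0ʳ <ʳ z) → (x ÷ʳ 0<z) *ʳ z ≈ʳ x
÷-*-cancel x {z} (apart δ 0<δ N δ≤z) = N , λ n n≥ →
  cancel (seq x n) (clamp-pos (seq z n) 0<δ)
    (sym (ℚₚ.p≥q⇒p⊔q≡p (subst (ℚ._≤ seq z n) (ℚₚ.+-identityˡ δ) (δ≤z n n≥))))
  where
  cancel : ∀ {c d} a (0<d : 0ℚ ℚ.< d) → c ≡ d → a ℚ.* (ℚ.1/ d) {{ℚ.>-nonZero 0<d}} ℚ.* c ≡ a
  cancel {d = d} a 0<d refl = trans (ℚₚ.*-assoc a _ d)
    (trans (cong (a ℚ.*_) (ℚₚ.*-inverseˡ d {{ℚ.>-nonZero 0<d}})) (ℚₚ.*-identityʳ a))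

≈ʳ-refl : ∀ {x} → x ≈ʳ x
≈ʳ-refl = 0 , λ _ _ → refl

≈ʳ-sym : ∀ {x y} → x ≈ʳ y → y ≈ʳ x
≈ʳ-sym (N , eq) = N , λ n n≥ → sym (eq n n≥)

<÷⇒*< : ∀ x y z (0<z : 0ʳ <ʳ z) → x <ʳ y ÷ʳ 0<z → x *ʳ z <ʳ y
<÷⇒*< x y z 0<z x<y÷z = <ʳ-resp-≈ʳ {x *ʳ z} {x *ʳ z} {(y ÷ʳ 0<z) *ʳ z} {y}
  (≈ʳ-refl {x *ʳ z}) (÷-*-cancel y 0<z) (*-monoˡ-<ʳ x (y ÷ʳ 0<z) z 0<z x<y÷z)

*<⇒<÷ : ∀ x y z (0<z : 0ʳ <ʳ z) → x *ʳ z <ʳ y → x <ʳ y ÷ʳ 0<z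
*<⇒<÷ x y z 0<z xz<y = *-cancelʳ-<ʳ x (y ÷ʳ 0<z) z 0<z
  (<ʳ-resp-≈ʳ {x *ʳ z} {x *ʳ z} {y} {(y ÷ʳ 0<z) *ʳ z}
    (≈ʳ-refl {x *ʳ z}) (≈ʳ-sym {(y ÷ʳ 0<z) *ʳ z} {y} (÷-*-cancel y 0<z)) xz<y)

-- Rounds one factor up to a rational without losing the strict inequality: any rational between x
-- and z / y serves.
*-cut : ∀ x y z → 0ʳ <ʳ y → x *ʳ y <ʳ z → ∃ λ q → x <ʳ ℚ⇒ℝ q × ℚ⇒ℝ q *ʳ y <ʳ z
*-cut x y z 0<y xy<z =
  let q , x<q , q<z÷y = <ʳ-dense x (z ÷ʳ 0<y) (*<⇒<÷ x z y 0<y xy<z)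
  in q , x<q , <÷⇒*< (ℚ⇒ℝ q) z y 0<y q<z÷y

*-cut₂ : ∀ x y r → 0ʳ <ʳ x → 0ʳ <ʳ y → x *ʳ y <ʳ ℚ⇒ℝ r →
         ∃ λ p → ∃ λ q → x <ʳ ℚ⇒ℝ p × y <ʳ ℚ⇒ℝ q × p ℚ.* q ℚ.< r
*-cut₂ x y r 0<x 0<y xy<r =
  let p , x<p , py<r = *-cut x y (ℚ⇒ℝ r) 0<y xy<r
      q , y<q , qp<r = *-cut y (ℚ⇒ℝ p) (ℚ⇒ℝ r) (0<-trans x (ℚ⇒ℝ p) 0<x x<p)
        (<ʳ-respˡ {ℚ⇒ℝ p *ʳ y} {y *ʳ ℚ⇒ℝ p} {ℚ⇒ℝ r} (λ n → ℚₚ.*-comm p (seq y n)) py<r)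
  in p , q , x<p , y<q , subst (ℚ._< r) (ℚₚ.*-comm q p) (<ʳ⇒ℚ-<
    (<ʳ-respˡ {ℚ⇒ℝ q *ʳ ℚ⇒ℝ p} {ℚ⇒ℝ (q ℚ.* p)} {ℚ⇒ℝ r} (λ _ → refl) qp<r))

-- Choice of λ and of the rational exponents

-- The two bounds on l say l (γ − 1) < α − ν γ and β μ ξ − α < l; the first one holds for l = 0, and
-- by the bound on β also for l = β μ ξ − α.  The variable D stands for γ − 1, so that it is not
-- unfolded to a sequence of rationals.
choose-λ : ∀ α ν γ μ ξ β D → (∀ n → seq D n ≡ seq γ n ℚ.- 1ℚ) →
  (0<D : 0ʳ <ʳ D) (0<μ : 0ʳ <ʳ μ) (0<ξ : 0ʳ <ʳ ξ) → ν *ʳ γ <ʳ α →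
  β <ʳ γ *ʳ (α -ʳ ν) ÷ʳ 0<-* (D *ʳ μ) ξ (0<-* D μ 0<D 0<μ) 0<ξ →
  ∃ λ l → 0ℚ ℚ.< l × (ℚ⇒ℝ l +ʳ ν) *ʳ γ <ʳ α +ʳ ℚ⇒ℝ l × β *ʳ (μ *ʳ ξ) <ʳ α +ʳ ℚ⇒ℝ l
choose-λ α ν γ μ ξ β D D≡γ-1 0<D 0<μ 0<ξ νγ<α β< =
  combine (*-cut 0ʳ D (α -ʳ ν *ʳ γ) 0<D 0D<) (*-cut (β *ʳ (μ *ʳ ξ) -ʳ α) D (α -ʳ ν *ʳ γ) 0<D XD<)
  where
  0D< : 0ʳ *ʳ D <ʳ α -ʳ ν *ʳ γ
  0D< = <ʳ-rearrange (ν *ʳ γ) α (0ʳ *ʳ D) (α -ʳ ν *ʳ γ)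
    (λ n → solve 3 (λ z d a → a :- z := a :- z :- con 0ℚ :* d)
      refl (seq (ν *ʳ γ) n) (seq D n) (seq α n))
    νγ<α

  -- Clear the denominator of the bound on β and use γ (α - ν) = (α - ν γ) + α (γ - 1).
  XD< : (β *ʳ (μ *ʳ ξ) -ʳ α) *ʳ D <ʳ α -ʳ ν *ʳ γ
  XD< = <ʳ-rearrange (β *ʳ (D *ʳ μ *ʳ ξ)) (γ *ʳ (α -ʳ ν)) ((β *ʳ (μ *ʳ ξ) -ʳ α) *ʳ D) (α -ʳ ν *ʳ γ)
    (λ n → ring (seq α n) (seq ν n) (seq γ n) (seq μ n) (seq ξ n) (seq β n) (D≡γ-1 n))
    (<÷⇒*< β (γ *ʳ (α -ʳ ν)) (D *ʳ μ *ʳ ξ) (0<-* (D *ʳ μ) ξ (0<-* D μ 0<D 0<μ) 0<ξ) β<)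
    where
    ring : ∀ a v g m x b {d} → d ≡ g ℚ.- 1ℚ →
           g ℚ.* (a ℚ.- v) ℚ.- b ℚ.* (d ℚ.* m ℚ.* x) ≡
           a ℚ.- v ℚ.* g ℚ.- (b ℚ.* (m ℚ.* x) ℚ.- a) ℚ.* d
    ring a v g m x b refl = solve 6 (λ a v g m x b →
      g :* (a :- v) :- b :* ((g :- con 1ℚ) :* m :* x) :=
      a :- v :* g :- (b :* (m :* x) :- a) :* (g :- con 1ℚ)) refl a v g m x b

  kernel-bound : ∀ l → ℚ⇒ℝ l *ʳ D <ʳ (α -ʳ ν *ʳ γ) → (ℚ⇒ℝ l +ʳ ν) *ʳ γ <ʳ α +ʳ ℚ⇒ℝ l
  kernel-bound l = <ʳ-rearrange (ℚ⇒ℝ l *ʳ D) (α -ʳ ν *ʳ γ) ((ℚ⇒ℝ l +ʳ ν) *ʳ γ) (α +ʳ ℚ⇒ℝ l)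
    λ n → ring (seq α n) (seq ν n) (seq γ n) (D≡γ-1 n)
    where
    ring : ∀ a v g {d} → d ≡ g ℚ.- 1ℚ →
           a ℚ.- v ℚ.* g ℚ.- l ℚ.* d ≡ a ℚ.+ l ℚ.- (l ℚ.+ v) ℚ.* g
    ring a v g refl = solve 4 (λ a v g l →
      a :- v :* g :- l :* (g :- con 1ℚ) := a :+ l :- (l :+ v) :* g) refl a v g l

  decision-bound : ∀ l → β *ʳ (μ *ʳ ξ) -ʳ α <ʳ ℚ⇒ℝ l → β *ʳ (μ *ʳ ξ) <ʳ α +ʳ ℚ⇒ℝ l
  decision-bound l = <ʳ-rearrange (β *ʳ (μ *ʳ ξ) -ʳ α) (ℚ⇒ℝ l) (β *ʳ (μ *ʳ ξ)) (α +ʳ ℚ⇒ℝ l)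
    λ n → solve 4 (λ a b m x → x :- (b :* m :- a) := a :+ x :- b :* m)
      refl (seq α n) (seq β n) (seq (μ *ʳ ξ) n) l

  combine : (∃ λ l → 0ʳ <ʳ ℚ⇒ℝ l × ℚ⇒ℝ l *ʳ D <ʳ α -ʳ ν *ʳ γ) →
            (∃ λ l → β *ʳ (μ *ʳ ξ) -ʳ α <ʳ ℚ⇒ℝ l × ℚ⇒ℝ l *ʳ D <ʳ α -ʳ ν *ʳ γ) →
            ∃ λ l → 0ℚ ℚ.< l × (ℚ⇒ℝ l +ʳ ν) *ʳ γ <ʳ α +ʳ ℚ⇒ℝ l × β *ʳ (μ *ʳ ξ) <ʳ α +ʳ ℚ⇒ℝ l
  combine (l , 0<l , lD<Z) (m , x<m , mD<Z) =
    -- `l` brings positivity and `m` exceeds β μ ξ - α; both obey the upper bound, hence so does the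
    -- maximum.
    l ℚ.⊔ m , ℚₚ.<-≤-trans (<ʳ⇒ℚ-< 0<l) (ℚₚ.p≤p⊔q l m) ,
    kernel-bound (l ℚ.⊔ m) (⊔-elim (λ q → ℚ⇒ℝ q *ʳ D <ʳ α -ʳ ν *ʳ γ) l m lD<Z mD<Z) ,
    decision-bound (l ℚ.⊔ m) (<ʳ-≤-trans (β *ʳ (μ *ʳ ξ) -ʳ α) x<m (ℚₚ.p≤q⊔p l m))

0<p : ∀ x {p} → 0ʳ <ʳ x → x <ʳ ℚ⇒ℝ p → 0ℚ ℚ.< p
0<p x {p} 0<x x<p = <ʳ⇒ℚ-< (0<-trans x (ℚ⇒ℝ p) 0<x x<p)

-- For x = α and s = α + λ this rounds α / (α + λ) up to a rational: z < s gives (x / s) z < x,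
-- which leaves the room.
÷-cut : ∀ x s (0<s : 0ʳ <ʳ s) {z} → 0ʳ <ʳ x → 0ℚ ℚ.< z → ℚ⇒ℝ z <ʳ s →
        ∃ λ q → 0ℚ ℚ.< q × x ÷ʳ 0<s <ʳ ℚ⇒ℝ q × ℚ⇒ℝ (q ℚ.* z) <ʳ x
÷-cut x s 0<s {z} 0<x 0<z z<s = rational (*-cut (x ÷ʳ 0<s) (ℚ⇒ℝ z) x (ℚ-<⇒<ʳ 0<z) cz<x)
  where
  0<c : 0ʳ <ʳ x ÷ʳ 0<s
  0<c = *<⇒<÷ 0ʳ x s 0<s (<ʳ-respˡ {0ʳ} {0ʳ *ʳ s} {x} (λ n → sym (ℚₚ.*-zeroˡ (seq s n))) 0<x)

  cz<x : (x ÷ʳ 0<s) *ʳ ℚ⇒ℝ z <ʳ x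
  cz<x = let N , cs≡x = ÷-*-cancel x 0<s in
    <ʳ-resp-≈ʳ {ℚ⇒ℝ z *ʳ (x ÷ʳ 0<s)} {(x ÷ʳ 0<s) *ʳ ℚ⇒ℝ z} {s *ʳ (x ÷ʳ 0<s)} {x}
      (0 , λ n _ → ℚₚ.*-comm z (seq (x ÷ʳ 0<s) n))
      (N , λ n n≥ → trans (ℚₚ.*-comm (seq s n) (seq (x ÷ʳ 0<s) n)) (cs≡x n n≥))
      (*-monoˡ-<ʳ (ℚ⇒ℝ z) s (x ÷ʳ 0<s) 0<c z<s)

  rational : (∃ λ q → x ÷ʳ 0<s <ʳ ℚ⇒ℝ q × ℚ⇒ℝ q *ʳ ℚ⇒ℝ z <ʳ x) →
             ∃ λ q → 0ℚ ℚ.< q × x ÷ʳ 0<s <ʳ ℚ⇒ℝ q × ℚ⇒ℝ (q ℚ.* z) <ʳ x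
  rational (q , c<q , qz<x) =
    q , 0<p (x ÷ʳ 0<s) 0<c c<q , c<q ,
    <ʳ-respˡ {ℚ⇒ℝ q *ʳ ℚ⇒ℝ z} {ℚ⇒ℝ (q ℚ.* z)} {x} (λ _ → refl) qz<x

-- `z` dominates the exponents of kernel and decision before the factor α / (α + λ). The slack
-- between `l + ν⁺` and `w` absorbs the polylogarithmic factors of the composed parameter; the one
-- between `z` and α + λ allows α / (α + λ) to be rounded up.
record Exponents (α ν γ μ ξ β : ℝ) (l : ℚ) : Set where
  field
    {w z ν⁺ γ⁺ μ⁺ ξ⁺ β⁺}    : ℚ
    ν<ν⁺                    : ν <ʳ ℚ⇒ℝ ν⁺
    γ<γ⁺                    : γ <ʳ ℚ⇒ℝ γ⁺
    μ<μ⁺                    : μ <ʳ ℚ⇒ℝ μ⁺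
    ξ<ξ⁺                    : ξ <ʳ ℚ⇒ℝ ξ⁺
    β<β⁺                    : β <ʳ ℚ⇒ℝ β⁺
    l+ν⁺<w                  : l ℚ.+ ν⁺ ℚ.< w
    wγ⁺<z                   : w ℚ.* γ⁺ ℚ.< z
    β⁺μ⁺ξ⁺<z                : β⁺ ℚ.* (μ⁺ ℚ.* ξ⁺) ℚ.< z
    z<α+l                   : ℚ⇒ℝ z <ʳ α +ʳ ℚ⇒ℝ l

+-cut : ∀ l x w → ℚ⇒ℝ l +ʳ x <ʳ ℚ⇒ℝ w → ∃ λ q → x <ʳ ℚ⇒ℝ q × l ℚ.+ q ℚ.< w
+-cut l x w l+x<w =
  let q , x<q , q<w-l = <ʳ-dense x (ℚ⇒ℝ (w ℚ.- l))
        (<ʳ-rearrange (ℚ⇒ℝ l +ʳ x) (ℚ⇒ℝ w) x (ℚ⇒ℝ (w ℚ.- l))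
          (λ n → solve 3 (λ l v w → w :- (l :+ v) := w :- l :- v) refl l (seq x n) w) l+x<w)
  in q , x<q , subst (l ℚ.+ q ℚ.<_) (solve 2 (λ l w → l :+ (w :- l) := w) refl l w)
                 (ℚₚ.+-monoʳ-< l (<ʳ⇒ℚ-< {q} {w ℚ.- l} q<w-l))

*-cut₃ : ∀ x y z r → 0ʳ <ʳ x → 0ʳ <ʳ y → 0ʳ <ʳ z → x *ʳ (y *ʳ z) <ʳ ℚ⇒ℝ r →
         ∃ λ o → ∃ λ p → ∃ λ q → x <ʳ ℚ⇒ℝ o × y <ʳ ℚ⇒ℝ p × z <ʳ ℚ⇒ℝ q × o ℚ.* (p ℚ.* q) ℚ.< r
*-cut₃ x y z r 0<x 0<y 0<z xyz<r =
  let o , s , x<o , yz<s , os<r = *-cut₂ x (y *ʳ z) r 0<x (0<-* y z 0<y 0<z) xyz<r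
      p , q , y<p , z<q , pq<s = *-cut₂ y z s 0<y 0<z yz<s
  in o , p , q , x<o , y<p , z<q ,
     ℚₚ.<-trans (ℚₚ.*-monoʳ-<-pos o {{ℚ.positive (0<p x {o} 0<x x<o)}} pq<s) os<r

exponents : ∀ α ν γ μ ξ β l → 0ℚ ℚ.< l →
  0ʳ <ʳ ν → 0ʳ <ʳ γ → 0ʳ <ʳ μ → 0ʳ <ʳ ξ → 0ʳ <ʳ β →
  (ℚ⇒ℝ l +ʳ ν) *ʳ γ <ʳ α +ʳ ℚ⇒ℝ l → β *ʳ (μ *ʳ ξ) <ʳ α +ʳ ℚ⇒ℝ l →
  Exponents α ν γ μ ξ β l
exponents α ν γ μ ξ β l 0<l 0<ν 0<γ 0<μ 0<ξ 0<β kernel< decision< =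
  let z₁ , kernel<z₁ , z₁<   = <ʳ-dense ((ℚ⇒ℝ l +ʳ ν) *ʳ γ) (α +ʳ ℚ⇒ℝ l) kernel<
      z₂ , decision<z₂ , z₂< = <ʳ-dense (β *ʳ (μ *ʳ ξ)) (α +ʳ ℚ⇒ℝ l) decision<
      w , γ⁺ , l+ν<w , γ<γ⁺ , wγ⁺<z₁ = *-cut₂ (ℚ⇒ℝ l +ʳ ν) γ z₁
        (0<-+ (ℚ⇒ℝ l) ν (ℚ-<⇒<ʳ {0ℚ} {l} 0<l) 0<ν) 0<γ kernel<z₁
      ν⁺ , ν<ν⁺ , l+ν⁺<w = +-cut l ν w l+ν<w
      β⁺ , μ⁺ , ξ⁺ , β<β⁺ , μ<μ⁺ , ξ<ξ⁺ , β⁺μ⁺ξ⁺<z₂ = *-cut₃ β μ ξ z₂ 0<β 0<μ 0<ξ decision<z₂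
  in record
    { w        = w
    ; z        = z₁ ℚ.⊔ z₂
    ; ν⁺       = ν⁺
    ; γ⁺       = γ⁺
    ; μ⁺       = μ⁺
    ; ξ⁺       = ξ⁺
    ; β⁺       = β⁺
    ; ν<ν⁺     = ν<ν⁺
    ; γ<γ⁺     = γ<γ⁺
    ; μ<μ⁺     = μ<μ⁺
    ; ξ<ξ⁺     = ξ<ξ⁺
    ; β<β⁺     = β<β⁺
    ; l+ν⁺<w   = l+ν⁺<w
    ; wγ⁺<z    = ℚₚ.<-≤-trans wγ⁺<z₁ (ℚₚ.p≤p⊔q z₁ z₂)
    ; β⁺μ⁺ξ⁺<z = ℚₚ.<-≤-trans β⁺μ⁺ξ⁺<z₂ (ℚₚ.p≤q⊔p z₁ z₂)
    ; z<α+l    = ⊔-elim (λ z → ℚ⇒ℝ z <ʳ α +ʳ ℚ⇒ℝ l) z₁ z₂ z₁< z₂<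
    }

-- Since α λ / (α + λ) = (α / (α + λ)) λ, the same rational `q` serves for the number of parts and
-- for their parameters.
÷-*-<ʳ : ∀ x s (0<s : 0ʳ <ʳ s) q {l} → 0ℚ ℚ.< l → x ÷ʳ 0<s <ʳ ℚ⇒ℝ q →
         x *ʳ ℚ⇒ℝ l ÷ʳ 0<s <ʳ ℚ⇒ℝ (q ℚ.* l)
÷-*-<ʳ x s 0<s q {l} 0<l c<q =
  <ʳ-respˡ {(x ÷ʳ 0<s) *ʳ ℚ⇒ℝ l} {x *ʳ ℚ⇒ℝ l ÷ʳ 0<s} {ℚ⇒ℝ (q ℚ.* l)}
    (λ n → solve 3 (λ x i l → x :* i :* l := x :* l :* i) refl (seq x n) (seq (1/ʳ 0<s) n) l)
    (<ʳ-respʳ {(x ÷ʳ 0<s) *ʳ ℚ⇒ℝ l} {ℚ⇒ℝ q *ʳ ℚ⇒ℝ l} {ℚ⇒ℝ (q ℚ.* l)} (λ _ → refl)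
      (*-monoˡ-<ʳ (x ÷ʳ 0<s) (ℚ⇒ℝ q) (ℚ⇒ℝ l) (ℚ-<⇒<ʳ {0ℚ} {l} 0<l) c<q))

-- A bound with real exponent is a family of bounds over all larger rationals. Taking ε as the gap δ
-- in p < α, eventually p ≤ α - δ, so `p` lies below each of them.
gap : ∀ {p} α → ℚ⇒ℝ p <ʳ α →
      ∃ λ ε → 0ʳ <ʳ ε × (∀ q → α -ʳ ε <ʳ ℚ⇒ℝ q → p ℚ.≤ q)
gap {p} α (apart δ 0<δ M p+δ≤α) = ℚ⇒ℝ δ , ℚ-<⇒<ʳ {0ℚ} {δ} 0<δ , λ q (apart η 0<η N α-δ+η≤q) →
  ℚ-+-cancelʳ-≤ η p q (begin
    p ℚ.+ η
      ≡⟨ solve 3 (λ p d e → p :+ e := p :+ d :- d :+ e) refl p δ η ⟩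
    p ℚ.+ δ ℚ.- δ ℚ.+ η
      ≤⟨ ℚₚ.+-monoˡ-≤ η (ℚₚ.+-monoˡ-≤ (ℚ.- δ) (p+δ≤α (M ⊔ N) (m≤m⊔n M N))) ⟩
    seq α (M ⊔ N) ℚ.- δ ℚ.+ η          ≤⟨ α-δ+η≤q (M ⊔ N) (m≤n⊔m M N) ⟩
    q                                  ≡⟨ ℚₚ.+-identityʳ q ⟨
    q ℚ.+ 0ℚ                           ≤⟨ ℚₚ.+-monoʳ-≤ q (ℚₚ.<⇒≤ 0<η) ⟩
    q ℚ.+ η                            ∎)
  where open ℚₚ.≤-Reasoning

-- Polynomial growth

^-distribʳ-* : ∀ m n k → (m * n) ^ k ≡ m ^ k * n ^ k
^-distribʳ-* m n zero    = refl
^-distribʳ-* m n (suc k) = trans (cong ((m * n) *_) (^-distribʳ-* m n k))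
  ([m*n]*[o*p]≡[m*o]*[n*p] m n (m ^ k) (n ^ k))

^-swap : ∀ m j k → (m ^ j) ^ k ≡ (m ^ k) ^ j
^-swap m j k = trans (^-*-assoc m j k) (trans (cong (m ^_) (*-comm j k)) (sym (^-*-assoc m k j)))

^-cancelˡ-≤ : ∀ k .{{_ : NonZero k}} {m n} → m ^ k ≤ n ^ k → m ≤ n
^-cancelˡ-≤ k mᵏ≤nᵏ = ≮⇒≥ λ n<m → <⇒≱ (^-monoˡ-< k n<m) mᵏ≤nᵏ

m≤m^n : ∀ m n .{{_ : NonZero n}} → m ≤ m ^ n
m≤m^n zero      n       = z≤n
m≤m^n m@(suc _) (suc n) = m≤m*n m (m ^ n) {{m^n≢0 m n}}

1≤m⊔1 : ∀ m → 1 ≤ m ⊔ 1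
1≤m⊔1 m = m≤n⊔m m 1

1≤[m⊔1]^n : ∀ m n → 1 ≤ (m ⊔ 1) ^ n
1≤[m⊔1]^n m n = m^n>0 (m ⊔ 1) {{ℕ.>-nonZero (1≤m⊔1 m)}} n

2^⌊log₂n⌋≤n : ∀ n .{{_ : NonZero n}} → 2 ^ ⌊log₂ n ⌋ ≤ n
2^⌊log₂n⌋≤n = <-rec (λ n → .{{_ : NonZero n}} → 2 ^ ⌊log₂ n ⌋ ≤ n) step
  where
  open ≤-Reasoning
  step : ∀ n → (∀ {m} → m < n → .{{_ : NonZero m}} → 2 ^ ⌊log₂ m ⌋ ≤ m) →
         .{{_ : NonZero n}} → 2 ^ ⌊log₂ n ⌋ ≤ n
  step 1 _ = ≤-refl
  step n@(suc (suc k)) rec = begin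
    2 ^ ⌊log₂ n ⌋                ≤⟨ ^-monoʳ-≤ 2 (m≤n+m∸n ⌊log₂ n ⌋ 1) ⟩
    2 * 2 ^ (⌊log₂ n ⌋ ∸ 1)      ≡⟨ cong (λ l → 2 * 2 ^ l) (⌊log₂⌊n/2⌋⌋≡⌊log₂n⌋∸1 n) ⟨
    2 * 2 ^ ⌊log₂ ⌊ n /2⌋ ⌋      ≤⟨ *-monoʳ-≤ 2 (rec (⌊n/2⌋<n (suc k))) ⟩
    2 * ⌊ n /2⌋
      ≤⟨ +-monoʳ-≤ ⌊ n /2⌋ (≤-trans (≤-reflexive (+-identityʳ _)) (⌊n/2⌋≤⌈n/2⌉ n)) ⟩
    ⌊ n /2⌋ + ℕ.⌈ n /2⌉          ≡⟨ ⌊n/2⌋+⌈n/2⌉≡n n ⟩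
    n                            ∎

n<2^n : ∀ n → n < 2 ^ n
n<2^n zero    = s≤s z≤n
n<2^n (suc n) = begin-strict
  suc n            <⟨ s≤s (n<2^n n) ⟩
  1 + 2 ^ n        ≤⟨ +-monoˡ-≤ (2 ^ n) (m^n>0 2 n) ⟩
  2 ^ n + 2 ^ n    ≡⟨ cong (2 ^ n +_) (sym (+-identityʳ _)) ⟩
  2 ^ suc n        ∎
  where open ≤-Reasoning

bits≤suc : ∀ n → bits n ≤ suc n
bits≤suc zero      = ≤-refl
bits≤suc n@(suc _) = s≤s (≤-trans (<⇒≤ (n<2^n ⌊log₂ n ⌋)) (2^⌊log₂n⌋≤n n))

-- With l = log₂ n, each of the k factors of (l + 1)ᵏ is at most k · 2^(l / k).
bits^k≤ : ∀ k n → bits n ^ k ≤ k ^ k * (n ⊔ 1)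
bits^k≤ zero      n = ≤-trans (1≤m⊔1 n) (m≤m+n _ _)
bits^k≤ k@(suc _) n = begin
  bits n ^ k                       ≤⟨ ^-monoˡ-≤ k factor ⟩
  (k * 2 ^ (l / k)) ^ k            ≡⟨ ^-distribʳ-* k (2 ^ (l / k)) k ⟩
  k ^ k * (2 ^ (l / k)) ^ k        ≡⟨ cong (k ^ k *_) (^-*-assoc 2 (l / k) k) ⟩
  k ^ k * 2 ^ (l / k * k)          ≤⟨ *-monoʳ-≤ (k ^ k) (^-monoʳ-≤ 2 l/k*k≤l) ⟩
  k ^ k * 2 ^ l                    ≤⟨ *-monoʳ-≤ (k ^ k) (power n) ⟩
  k ^ k * (n ⊔ 1)                  ∎
  where
  open ≤-Reasoning
  l = ⌊log₂ n ⌋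
  l/k*k≤l : l / k * k ≤ l
  l/k*k≤l = ≤-trans (m≤n+m _ (l % k)) (≤-reflexive (sym (m≡m%n+[m/n]*n l k)))
  power : ∀ n → 2 ^ ⌊log₂ n ⌋ ≤ n ⊔ 1
  power zero      = ≤-refl
  power n@(suc _) = ≤-trans (2^⌊log₂n⌋≤n n) (m≤m⊔n n 1)
  factor : bits n ≤ k * 2 ^ (l / k)
  factor = begin
    suc l                      ≡⟨ cong suc (m≡m%n+[m/n]*n l k) ⟩
    suc (l % k) + l / k * k    ≤⟨ +-monoˡ-≤ _ (m%n<n l k) ⟩
    suc (l / k) * k            ≡⟨ *-comm (suc (l / k)) k ⟩
    k * suc (l / k)            ≤⟨ *-monoʳ-≤ k (n<2^n (l / k)) ⟩
    k * 2 ^ (l / k)            ∎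

-- The natural numbers inside ℚ

-- Repeated addition of 1 lets the laws follow by induction, without reduction to lowest terms.
⌜_⌝ : ℕ → ℚ
⌜ zero ⌝  = 0ℚ
⌜ suc n ⌝ = 1ℚ ℚ.+ ⌜ n ⌝

⌜⌝-+ : ∀ m n → ⌜ m + n ⌝ ≡ ⌜ m ⌝ ℚ.+ ⌜ n ⌝
⌜⌝-+ zero    n = sym (ℚₚ.+-identityˡ ⌜ n ⌝)
⌜⌝-+ (suc m) n = trans (cong (1ℚ ℚ.+_) (⌜⌝-+ m n)) (sym (ℚₚ.+-assoc 1ℚ ⌜ m ⌝ ⌜ n ⌝))

⌜⌝-* : ∀ m n → ⌜ m * n ⌝ ≡ ⌜ m ⌝ ℚ.* ⌜ n ⌝
⌜⌝-* zero    n = sym (ℚₚ.*-zeroˡ ⌜ n ⌝)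
⌜⌝-* (suc m) n = trans (⌜⌝-+ n (m * n)) (trans (cong (⌜ n ⌝ ℚ.+_) (⌜⌝-* m n))
  (solve 2 (λ m n → n :+ m :* n := (con 1ℚ :+ m) :* n) refl ⌜ m ⌝ ⌜ n ⌝))

0≤⌜⌝ : ∀ n → 0ℚ ℚ.≤ ⌜ n ⌝
0≤⌜⌝ zero    = ℚₚ.≤-refl
0≤⌜⌝ (suc n) = ℚₚ.+-mono-≤ (ℚₚ.nonNegative⁻¹ 1ℚ) (0≤⌜⌝ n)

⌜⌝-mono-≤ : ∀ {m n} → m ≤ n → ⌜ m ⌝ ℚ.≤ ⌜ n ⌝
⌜⌝-mono-≤ {n = n} z≤n = 0≤⌜⌝ n
⌜⌝-mono-≤ (s≤s m≤n)   = ℚₚ.+-monoʳ-≤ 1ℚ (⌜⌝-mono-≤ m≤n)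

⌜⌝-mono-< : ∀ {m n} → m < n → ⌜ m ⌝ ℚ.< ⌜ n ⌝
⌜⌝-mono-< {m} m<n = ℚₚ.<-≤-trans
  (subst (ℚ._< ⌜ suc m ⌝) (ℚₚ.+-identityˡ ⌜ m ⌝) (ℚₚ.+-monoˡ-< ⌜ m ⌝ (ℚₚ.positive⁻¹ 1ℚ)))
  (⌜⌝-mono-≤ m<n)

⌜⌝-cancel-≤ : ∀ {m n} → ⌜ m ⌝ ℚ.≤ ⌜ n ⌝ → m ≤ n
⌜⌝-cancel-≤ m≤n = ≮⇒≥ λ n<m → ℚₚ.<-irrefl refl (ℚₚ.<-≤-trans (⌜⌝-mono-< n<m) m≤n)

toℚᵘ-⌜⌝ : ∀ n → ℚ.toℚᵘ ⌜ n ⌝ ℚᵘ.≃ ℚᵘ.mkℚᵘ (ℤ.+ n) 0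
toℚᵘ-⌜⌝ zero    = ℚᵘₚ.≃-refl
toℚᵘ-⌜⌝ (suc n) = ℚᵘₚ.≃-trans (ℚₚ.toℚᵘ-homo-+ 1ℚ ⌜ n ⌝)
  (ℚᵘₚ.≃-trans (ℚᵘₚ.+-congʳ (ℚ.toℚᵘ 1ℚ) (toℚᵘ-⌜⌝ n))
    (ℚᵘ.*≡* (cong (λ k → (ℤ.+ 1 ℤ.+ k) ℤ.* ℤ.+ 1) (ℤₚ.*-identityʳ (ℤ.+ n)))))

-- Proved among unnormalised rationals, where equality is cross-multiplication.
↧*q≡↥ : ∀ {q} → 0ℚ ℚ.≤ q → ⌜ ↧ₙ q ⌝ ℚ.* q ≡ ⌜ (↥ q) ⁺ ⌝
↧*q≡↥ {q@(mkℚ (ℤ.+ n) d-1 _)} _ = ℚₚ.toℚᵘ-injective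
  (ℚᵘₚ.≃-trans (ℚₚ.toℚᵘ-homo-* ⌜ suc d-1 ⌝ q)
    (ℚᵘₚ.≃-trans (ℚᵘₚ.*-congʳ (toℚᵘ-⌜⌝ (suc d-1)))
      (ℚᵘₚ.≃-trans (ℚᵘ.*≡* (trans (ℤₚ.*-identityʳ _)
          (trans (ℤₚ.*-comm (ℤ.+ suc d-1) (ℤ.+ n))
            (cong (λ k → ℤ.+ n ℤ.* ℤ.+ suc k) (sym (+-identityʳ d-1))))))
        (ℚᵘₚ.≃-sym (toℚᵘ-⌜⌝ n)))))
↧*q≡↥ {mkℚ -[1+ n ] d-1 _} (ℚ.*≤* ())

↥⁻≡0 : ∀ {q} → 0ℚ ℚ.≤ q → (↥ q) ⁻ ≡ 0
↥⁻≡0 {mkℚ (ℤ.+ n) _ _}    _ = refl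
↥⁻≡0 {mkℚ -[1+ n ] _ _} (ℚ.*≤* ())

↥⁺-pos : ∀ {q} → 0ℚ ℚ.< q → 1 ≤ (↥ q) ⁺
↥⁺-pos {mkℚ (ℤ.+ suc n) _ _}    _ = s≤s z≤n
↥⁺-pos {mkℚ (ℤ.+ zero) _ _} (ℚ.*<* (ℤ.+<+ ()))
↥⁺-pos {mkℚ -[1+ n ] _ _} (ℚ.*<* ())

-- The denominator times δ is the numerator, which is at least 1; hence k = n · `↧ₙ δ`.
archimedean : ∀ {δ} → 0ℚ ℚ.< δ → ∀ n → ∃ λ k → ⌜ n ⌝ ℚ.≤ ⌜ k ⌝ ℚ.* δ
archimedean {δ} 0<δ n = n * ↧ₙ δ , (begin
  ⌜ n ⌝                              ≤⟨ ⌜⌝-mono-≤ (m≤m*n n ((↥ δ) ⁺) {{ℕ.>-nonZero (↥⁺-pos 0<δ)}}) ⟩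
  ⌜ n * (↥ δ) ⁺ ⌝                    ≡⟨ ⌜⌝-* n _ ⟩
  ⌜ n ⌝ ℚ.* ⌜ (↥ δ) ⁺ ⌝              ≡⟨ cong (⌜ n ⌝ ℚ.*_) (↧*q≡↥ (ℚₚ.<⇒≤ 0<δ)) ⟨
  ⌜ n ⌝ ℚ.* (⌜ ↧ₙ δ ⌝ ℚ.* δ)         ≡⟨ ℚₚ.*-assoc ⌜ n ⌝ ⌜ ↧ₙ δ ⌝ δ ⟨
  ⌜ n ⌝ ℚ.* ⌜ ↧ₙ δ ⌝ ℚ.* δ           ≡⟨ cong (ℚ._* δ) (⌜⌝-* n (↧ₙ δ)) ⟨
  ⌜ n * ↧ₙ δ ⌝ ℚ.* δ                 ∎)
  where open ℚₚ.≤-Reasoning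

-- Calculus of growth bounds with rational exponents

-- This is f ∈ O(b^q) for q ≥ 0.  Any fraction num / den ≤ q may serve, so that sums and products
-- of exponents need not be brought to lowest terms.
record _≼_^_ {X : Set} (f b : X → ℕ) (q : ℚ) : Set where
  constructor bound
  field
    num den C   : ℕ
    den≢0       : NonZero den
    exponent    : ⌜ num ⌝ ℚ.≤ ⌜ den ⌝ ℚ.* q
    holds       : ∀ x → f x ^ den ≤ C * (b x ⊔ 1) ^ num

module _ {X : Set} where

  ≼-mono : {f g b : X → ℕ} {q : ℚ} → (∀ x → f x ≤ g x) → g ≼ b ^ q → f ≼ b ^ q
  ≼-mono f≤g (bound u d C d≢0 u≤dq g≤) =
    bound u d C d≢0 u≤dq λ x → ≤-trans (^-monoˡ-≤ d (f≤g x)) (g≤ x)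

  ≼-weaken : {f b : X → ℕ} {q r : ℚ} → q ℚ.≤ r → f ≼ b ^ q → f ≼ b ^ r
  ≼-weaken q≤r (bound u d C d≢0 u≤dq f≤) = bound u d C d≢0
    (ℚₚ.≤-trans u≤dq (ℚₚ.*-monoˡ-≤-nonNeg ⌜ d ⌝ {{ℚ.nonNegative (0≤⌜⌝ d)}} q≤r)) f≤

  ≼-resp-≡ : {f b : X → ℕ} {q r : ℚ} → q ≡ r → f ≼ b ^ q → f ≼ b ^ r
  ≼-resp-≡ refl f≼ = f≼

  ≼-const : {b : X → ℕ} (c : ℕ) → const c ≼ b ^ 0ℚ
  ≼-const c = bound 0 1 c _ ℚₚ.≤-refl λ _ → ≤-refl

  ≼-refl : {b : X → ℕ} → b ≼ b ^ 1ℚ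
  ≼-refl {b} = bound 1 1 1 _ ℚₚ.≤-refl λ x → begin
    b x * 1              ≤⟨ *-monoˡ-≤ 1 (m≤m⊔n (b x) 1) ⟩
    (b x ⊔ 1) ^ 1        ≤⟨ m≤m+n _ _ ⟩
    1 * (b x ⊔ 1) ^ 1    ∎
    where open ≤-Reasoning

  ≼-* : {f g b : X → ℕ} {q r : ℚ} → f ≼ b ^ q → g ≼ b ^ r → (λ x → f x * g x) ≼ b ^ (q ℚ.+ r)
  ≼-* {f} {g} {b} {q} {r} (bound u d C d≢0 u≤dq f≤) (bound v e D e≢0 v≤er g≤) =
    bound (u * e + v * d) (d * e) (C ^ e * D ^ d) (m*n≢0 d e {{d≢0}} {{e≢0}}) expo λ x →
      let
        B = b x ⊔ 1
        open ≤-Reasoning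
      in begin
      (f x * g x) ^ (d * e)                             ≡⟨ ^-distribʳ-* (f x) (g x) (d * e) ⟩
      f x ^ (d * e) * g x ^ (d * e)
        ≡⟨ cong₂ _*_ (^-*-assoc (f x) d e)
             (trans (^-*-assoc (g x) e d) (cong (g x ^_) (*-comm e d))) ⟨
      (f x ^ d) ^ e * (g x ^ e) ^ d
        ≤⟨ *-mono-≤ (^-monoˡ-≤ e (f≤ x)) (^-monoˡ-≤ d (g≤ x)) ⟩
      (C * B ^ u) ^ e * (D * B ^ v) ^ d
        ≡⟨ cong₂ _*_ (^-distribʳ-* C (B ^ u) e) (^-distribʳ-* D (B ^ v) d) ⟩
      (C ^ e * (B ^ u) ^ e) * (D ^ d * (B ^ v) ^ d)
        ≡⟨ cong₂ (λ k l → C ^ e * k * (D ^ d * l))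
             (^-*-assoc B u e) (^-*-assoc B v d) ⟩
      (C ^ e * B ^ (u * e)) * (D ^ d * B ^ (v * d))
        ≡⟨ [m*n]*[o*p]≡[m*o]*[n*p] (C ^ e) (B ^ (u * e)) (D ^ d) (B ^ (v * d)) ⟩
      C ^ e * D ^ d * (B ^ (u * e) * B ^ (v * d))
        ≡⟨ cong (C ^ e * D ^ d *_) (^-distribˡ-+-* B (u * e) (v * d)) ⟨
      C ^ e * D ^ d * B ^ (u * e + v * d)               ∎
    where
    expo : ⌜ u * e + v * d ⌝ ℚ.≤ ⌜ d * e ⌝ ℚ.* (q ℚ.+ r)
    expo = begin
      ⌜ u * e + v * d ⌝
        ≡⟨ trans (⌜⌝-+ (u * e) (v * d)) (cong₂ ℚ._+_ (⌜⌝-* u e) (⌜⌝-* v d)) ⟩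
      ⌜ u ⌝ ℚ.* ⌜ e ⌝ ℚ.+ ⌜ v ⌝ ℚ.* ⌜ d ⌝
        ≤⟨ ℚₚ.+-mono-≤
             (ℚₚ.*-monoʳ-≤-nonNeg ⌜ e ⌝ {{ℚ.nonNegative (0≤⌜⌝ e)}} u≤dq)
             (ℚₚ.*-monoʳ-≤-nonNeg ⌜ d ⌝ {{ℚ.nonNegative (0≤⌜⌝ d)}} v≤er) ⟩
      ⌜ d ⌝ ℚ.* q ℚ.* ⌜ e ⌝ ℚ.+ ⌜ e ⌝ ℚ.* r ℚ.* ⌜ d ⌝  ≡⟨ ring ⌜ d ⌝ ⌜ e ⌝ q r ⟩
      (⌜ d ⌝ ℚ.* ⌜ e ⌝) ℚ.* (q ℚ.+ r)                  ≡⟨ cong (ℚ._* (q ℚ.+ r)) (⌜⌝-* d e) ⟨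
      ⌜ d * e ⌝ ℚ.* (q ℚ.+ r)                          ∎
      where
      open ℚₚ.≤-Reasoning
      ring : ∀ d e q r → d ℚ.* q ℚ.* e ℚ.+ e ℚ.* r ℚ.* d ≡ (d ℚ.* e) ℚ.* (q ℚ.+ r)
      ring = solve 4 (λ d e q r → d :* q :* e :+ e :* r :* d := (d :* e) :* (q :+ r)) refl

  ≼-^ : {f b : X → ℕ} {q : ℚ} (k : ℕ) → f ≼ b ^ q → (λ x → f x ^ k) ≼ b ^ (⌜ k ⌝ ℚ.* q)
  ≼-^ {f} {b} {q} k (bound u d C d≢0 u≤dq f≤) = bound (k * u) d (C ^ k) d≢0 expo λ x →
    let
      B = b x ⊔ 1
      open ≤-Reasoning
    in begin
    (f x ^ k) ^ d              ≡⟨ ^-swap (f x) k d ⟩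
    (f x ^ d) ^ k              ≤⟨ ^-monoˡ-≤ k (f≤ x) ⟩
    (C * B ^ u) ^ k            ≡⟨ ^-distribʳ-* C (B ^ u) k ⟩
    C ^ k * (B ^ u) ^ k
      ≡⟨ cong (C ^ k *_) (trans (^-*-assoc B u k) (cong (B ^_) (*-comm u k))) ⟩
    C ^ k * B ^ (k * u)        ∎
    where
    expo : ⌜ k * u ⌝ ℚ.≤ ⌜ d ⌝ ℚ.* (⌜ k ⌝ ℚ.* q)
    expo = begin
      ⌜ k * u ⌝                    ≡⟨ ⌜⌝-* k u ⟩
      ⌜ k ⌝ ℚ.* ⌜ u ⌝              ≤⟨ ℚₚ.*-monoˡ-≤-nonNeg ⌜ k ⌝ {{ℚ.nonNegative (0≤⌜⌝ k)}} u≤dq ⟩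
      ⌜ k ⌝ ℚ.* (⌜ d ⌝ ℚ.* q)
        ≡⟨ solve 3 (λ k d q → k :* (d :* q) := d :* (k :* q)) refl ⌜ k ⌝ ⌜ d ⌝ q ⟩
      ⌜ d ⌝ ℚ.* (⌜ k ⌝ ℚ.* q)      ∎
      where
      open ℚₚ.≤-Reasoning

  -- Bounds with a rational exponent speak about powers of f. The root is taken by enlarging the
  -- denominator of the exponent, never on natural numbers.
  ≼-root : {f g b : X → ℕ} {q : ℚ} (k : ℕ) .{{_ : NonZero k}} →
           (∀ x → f x ^ k ≤ g x) → g ≼ b ^ (⌜ k ⌝ ℚ.* q) → f ≼ b ^ q
  ≼-root {f} {g} {b} {q} k f^k≤g (bound u d C d≢0 u≤dkq g≤) =
    bound u (d * k) C (m*n≢0 d k {{d≢0}}) expo λ x →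
      let
        B = b x ⊔ 1
        open ≤-Reasoning
      in begin
      f x ^ (d * k)        ≡⟨ trans (cong (f x ^_) (*-comm d k)) (sym (^-*-assoc (f x) k d)) ⟩
      (f x ^ k) ^ d        ≤⟨ ^-monoˡ-≤ d (f^k≤g x) ⟩
      g x ^ d              ≤⟨ g≤ x ⟩
      C * B ^ u            ∎
    where
    expo : ⌜ u ⌝ ℚ.≤ ⌜ d * k ⌝ ℚ.* q
    expo = ℚₚ.≤-trans u≤dkq (ℚₚ.≤-reflexive
      (trans (sym (ℚₚ.*-assoc ⌜ d ⌝ ⌜ k ⌝ q)) (cong (ℚ._* q) (sym (⌜⌝-* d k)))))

  -- Bases are read as max(b, 1), so a bound can serve as the base of another one only after this
  -- adjustment.
  ≼-⊔1 : {f b : X → ℕ} {q : ℚ} → f ≼ b ^ q → (λ x → f x ⊔ 1) ≼ b ^ q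
  ≼-⊔1 {f} {b} (bound u d C d≢0 u≤dq f≤) = bound u d (suc C) d≢0 u≤dq λ x →
    let
      B = b x ⊔ 1
      open ≤-Reasoning
    in begin
    (f x ⊔ 1) ^ d                ≤⟨ pow-⊔1 (f x) d ⟩
    1 + f x ^ d                  ≤⟨ +-mono-≤ (1≤[m⊔1]^n (b x) u) (f≤ x) ⟩
    suc C * B ^ u                ∎
    where
    pow-⊔1 : ∀ m d → (m ⊔ 1) ^ d ≤ 1 + m ^ d
    pow-⊔1 zero      d = ≤-trans (≤-reflexive (^-zeroˡ d)) (m≤m+n 1 _)
    pow-⊔1 m@(suc k) d = ≤-trans (≤-reflexive (cong (_^ d) (m≥n⇒m⊔n≡m (s≤s z≤n)))) (m≤n+m _ 1)

  ≼-trans : {f g b : X → ℕ} {q r : ℚ} → 0ℚ ℚ.≤ r → f ≼ g ^ q → g ≼ b ^ r → f ≼ b ^ (q ℚ.* r)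
  ≼-trans {q = q} {r} 0≤r (bound u d C d≢0 u≤dq f≤) g≼b = ≼-root d {{d≢0}} f≤
    (≼-weaken weaker (≼-* (≼-const C) (≼-^ u (≼-⊔1 g≼b))))
    where
    weaker : 0ℚ ℚ.+ ⌜ u ⌝ ℚ.* r ℚ.≤ ⌜ d ⌝ ℚ.* (q ℚ.* r)
    weaker = begin
      0ℚ ℚ.+ ⌜ u ⌝ ℚ.* r         ≡⟨ ℚₚ.+-identityˡ _ ⟩
      ⌜ u ⌝ ℚ.* r                ≤⟨ ℚₚ.*-monoʳ-≤-nonNeg r {{ℚ.nonNegative 0≤r}} u≤dq ⟩
      ⌜ d ⌝ ℚ.* q ℚ.* r          ≡⟨ ℚₚ.*-assoc ⌜ d ⌝ q r ⟩
      ⌜ d ⌝ ℚ.* (q ℚ.* r)        ∎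
      where open ℚₚ.≤-Reasoning

  ≼-⊔ : {f g b : X → ℕ} {q : ℚ} → f ≼ b ^ q → g ≼ b ^ q → (λ x → f x ⊔ g x) ≼ b ^ q
  ≼-⊔ {f} {g} {b} {q} (bound u d C d≢0 u≤dq f≤) (bound v e D e≢0 v≤eq g≤) =
    bound (u * e ⊔ v * d) (d * e) (C ^ e + D ^ d) (m*n≢0 d e {{d≢0}} {{e≢0}})
      (⌜⊔⌝-lub (u * e) (v * d)
        (raise u d e u≤dq)
        (ℚₚ.≤-trans (raise v e d v≤eq)
          (ℚₚ.≤-reflexive (cong (λ k → ⌜ k ⌝ ℚ.* q) (*-comm e d))))) λ x →
      let
        B = b x ⊔ 1
        instance B≢0 = ℕ.>-nonZero (1≤m⊔1 (b x))
        open ≤-Reasoning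
      in begin
      (f x ⊔ g x) ^ (d * e)                                ≤⟨ pow-⊔ (f x) (g x) (d * e) ⟩
      f x ^ (d * e) + g x ^ (d * e)
        ≤⟨ +-mono-≤ (power {u = u} x d e (f≤ x)) (≤-trans
             (≤-reflexive (cong (g x ^_) (*-comm d e))) (power {u = v} x e d (g≤ x))) ⟩
      C ^ e * B ^ (u * e) + D ^ d * B ^ (v * d)
        ≤⟨ +-mono-≤
             (*-monoʳ-≤ (C ^ e) (^-monoʳ-≤ B (m≤m⊔n (u * e) (v * d))))
             (*-monoʳ-≤ (D ^ d) (^-monoʳ-≤ B (m≤n⊔m (u * e) (v * d)))) ⟩
      C ^ e * B ^ (u * e ⊔ v * d) + D ^ d * B ^ (u * e ⊔ v * d)
        ≡⟨ *-distribʳ-+ (B ^ (u * e ⊔ v * d)) (C ^ e) (D ^ d) ⟨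
      (C ^ e + D ^ d) * B ^ (u * e ⊔ v * d)                ∎
    where
    power : ∀ {m C u} x d e → m ^ d ≤ C * (b x ⊔ 1) ^ u → m ^ (d * e) ≤ C ^ e * (b x ⊔ 1) ^ (u * e)
    power {m} {C} {u} x d e le =
      let
        B = b x ⊔ 1
        open ≤-Reasoning
      in begin
      m ^ (d * e)              ≡⟨ ^-*-assoc m d e ⟨
      (m ^ d) ^ e              ≤⟨ ^-monoˡ-≤ e le ⟩
      (C * B ^ u) ^ e
        ≡⟨ trans (^-distribʳ-* C (B ^ u) e) (cong (C ^ e *_) (^-*-assoc B u e)) ⟩
      C ^ e * B ^ (u * e)      ∎
    pow-⊔ : ∀ m n k → (m ⊔ n) ^ k ≤ m ^ k + n ^ k
    pow-⊔ m n k with ≤-total m n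
    ... | inj₁ m≤n = ≤-trans (≤-reflexive (cong (_^ k) (m≤n⇒m⊔n≡n m≤n))) (m≤n+m _ _)
    ... | inj₂ n≤m = ≤-trans (≤-reflexive (cong (_^ k) (m≥n⇒m⊔n≡m n≤m))) (m≤m+n _ _)
    ⌜⊔⌝-lub : ∀ m n {r} → ⌜ m ⌝ ℚ.≤ r → ⌜ n ⌝ ℚ.≤ r → ⌜ m ⊔ n ⌝ ℚ.≤ r
    ⌜⊔⌝-lub m n m≤r n≤r with ⊔-sel m n
    ... | inj₁ eq = subst (λ k → ⌜ k ⌝ ℚ.≤ _) (sym eq) m≤r
    ... | inj₂ eq = subst (λ k → ⌜ k ⌝ ℚ.≤ _) (sym eq) n≤r
    raise : ∀ u d e → ⌜ u ⌝ ℚ.≤ ⌜ d ⌝ ℚ.* q → ⌜ u * e ⌝ ℚ.≤ ⌜ d * e ⌝ ℚ.* q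
    raise u d e le = begin
      ⌜ u * e ⌝                    ≡⟨ ⌜⌝-* u e ⟩
      ⌜ u ⌝ ℚ.* ⌜ e ⌝              ≤⟨ ℚₚ.*-monoʳ-≤-nonNeg ⌜ e ⌝ {{ℚ.nonNegative (0≤⌜⌝ e)}} le ⟩
      ⌜ d ⌝ ℚ.* q ℚ.* ⌜ e ⌝
        ≡⟨ solve 3 (λ d q e → d :* q :* e := (d :* e) :* q) refl ⌜ d ⌝ q ⌜ e ⌝ ⟩
      (⌜ d ⌝ ℚ.* ⌜ e ⌝) ℚ.* q      ≡⟨ cong (ℚ._* q) (⌜⌝-* d e) ⟨
      ⌜ d * e ⌝ ℚ.* q              ∎
      where
      open ℚₚ.≤-Reasoning

  ≼-+ : {f g b : X → ℕ} {q : ℚ} → f ≼ b ^ q → g ≼ b ^ q → (λ x → f x + g x) ≼ b ^ q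
  ≼-+ {f} {g} {b} {q} f≼ g≼ = ≼-mono f+g≤
    (≼-resp-≡ (ℚₚ.+-identityˡ q) (≼-* (≼-const 2) (≼-⊔ f≼ g≼)))
    where
    f+g≤ : ∀ x → f x + g x ≤ 2 * (f x ⊔ g x)
    f+g≤ x = +-mono-≤ (m≤m⊔n (f x) (g x)) (≤-trans (m≤n⊔m (f x) (g x)) (m≤m+n _ 0))

  -- Any polynomial bound f ≤ C B^u is enough. With u ≤ j δ, the power `suc j` of the polylogarithm
  -- is still a power of `bits (f x)`, hence O(f) and O(B^u). The successor keeps the denominator
  -- nonzero.
  ≼-polylog : {f b : X → ℕ} {q δ : ℚ} (k : ℕ) → 0ℚ ℚ.< δ → f ≼ b ^ q →
              (λ x → bits (f x) ^ k) ≼ b ^ δ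
  ≼-polylog {f} {b} {q} {δ} k 0<δ f≼ with ≼-⊔1 f≼
  ... | bound u d C d≢0 _ f≤ = let j , u≤jδ = archimedean 0<δ u ; n = k * suc j in
    bound u (suc j) (n ^ n * C) _
      (ℚₚ.≤-trans u≤jδ
        (ℚₚ.*-monoʳ-≤-nonNeg δ {{ℚ.nonNegative (ℚₚ.<⇒≤ 0<δ)}} (⌜⌝-mono-≤ (n≤1+n j)))) λ x →
    let
      B = b x ⊔ 1
      open ≤-Reasoning
    in begin
    (bits (f x) ^ k) ^ suc j         ≡⟨ ^-*-assoc (bits (f x)) k (suc j) ⟩
    bits (f x) ^ n                   ≤⟨ bits^k≤ n (f x) ⟩
    n ^ n * (f x ⊔ 1)
      ≤⟨ *-monoʳ-≤ (n ^ n) (≤-trans (m≤m^n (f x ⊔ 1) d {{d≢0}}) (f≤ x)) ⟩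
    n ^ n * (C * B ^ u)              ≡⟨ *-assoc (n ^ n) C (B ^ u) ⟨
    n ^ n * C * B ^ u                ∎

  -- δ pays for the hidden factor. The additive term of the bound is a truncated subtraction, so f
  -- is split into f ∸ S and S, and the two are estimated separately.
  Õ⇒≼ : {f t b s B : X → ℕ} {r : ℝ} {q τ χ κ δ ρ : ℚ} → f ∈Õ[ t · b ^ r + s ] →
        r <ʳ ℚ⇒ℝ q → 0ℚ ℚ.≤ q → t ≼ B ^ τ → b ≼ B ^ χ → s ≼ B ^ κ →
        0ℚ ℚ.< δ → δ ℚ.+ (τ ℚ.+ q ℚ.* χ) ℚ.≤ ρ → δ ℚ.+ κ ℚ.≤ ρ → f ≼ B ^ ρ
  Õ⇒≼ {f} {t} {b} {s} {B} {r} {q} {τ} {χ} {κ} {δ} (C , k , f≤) r<q 0≤q t≼ b≼ s≼ 0<δ main≤ρ rest≤ρ =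
    ≼-mono split (≼-+ (≼-weaken main≤ρ main) (≼-weaken rest≤ρ rest))
    where
    d = ↧ₙ q
    u = (↥ q) ⁺
    polylog A S : X → ℕ
    polylog x = bits (t x * (b x ⊔ 1) + s x) ^ k
    A x = C * polylog x * t x
    S x = C * polylog x * s x

    split : ∀ x → f x ≤ (f x ∸ S x) + S x
    split x = ≤-trans (m≤n+m∸n (f x) (S x)) (≤-reflexive (+-comm (S x) _))

    Cpolylog : (λ x → C * polylog x) ≼ B ^ δ
    Cpolylog = ≼-resp-≡ (ℚₚ.+-identityˡ δ) (≼-* (≼-const C) (≼-polylog k 0<δ
      (≼-+ (≼-weaken (ℚₚ.p≤p⊔q _ κ) (≼-* t≼ (≼-⊔1 b≼))) (≼-weaken (ℚₚ.p≤q⊔p (τ ℚ.+ χ) κ) s≼))))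

    rest : S ≼ B ^ (δ ℚ.+ κ)
    rest = ≼-* Cpolylog s≼

    main-exponent : ⌜ d ⌝ ℚ.* (δ ℚ.+ τ) ℚ.+ ⌜ u ⌝ ℚ.* χ ≡ ⌜ d ⌝ ℚ.* (δ ℚ.+ (τ ℚ.+ q ℚ.* χ))
    main-exponent = trans (cong (λ v → ⌜ d ⌝ ℚ.* (δ ℚ.+ τ) ℚ.+ v ℚ.* χ) (sym (↧*q≡↥ 0≤q)))
      (solve 5 (λ d δ τ q χ → d :* (δ :+ τ) :+ (d :* q) :* χ := d :* (δ :+ (τ :+ q :* χ)))
        refl ⌜ d ⌝ δ τ q χ)

    main : (λ x → f x ∸ S x) ≼ B ^ (δ ℚ.+ (τ ℚ.+ q ℚ.* χ))
    main = ≼-root d f^d≤ (≼-resp-≡ main-exponent (≼-* (≼-^ d (≼-* Cpolylog t≼)) (≼-^ u (≼-⊔1 b≼))))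
      where
      f^d≤ : ∀ x → (f x ∸ S x) ^ d ≤ A x ^ d * (b x ⊔ 1) ^ u
      f^d≤ x = subst (_≤ A x ^ d * (b x ⊔ 1) ^ u)
        (trans (cong (λ v → (f x ∸ S x) ^ d * (b x ⊔ 1) ^ v) (↥⁻≡0 0≤q)) (*-identityʳ _))
        (f≤ x q r<q)

  Õ₁⇒≼ : {f b : X → ℕ} {r : ℝ} {q q′ : ℚ} → f ∈Õ[ b ^ r ] →
         r <ʳ ℚ⇒ℝ q → 0ℚ ℚ.≤ q → q ℚ.< q′ → f ≼ b ^ q′
  Õ₁⇒≼ {q = q} {q′} f∈ r<q 0≤q q<q′ = Õ⇒≼ f∈ r<q 0≤q (≼-const 1) ≼-refl (≼-const 0) (p<q⇒0<q-p q<q′)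
    (ℚₚ.≤-reflexive (solve 2 (λ q q′ → (q′ :- q) :+ (con 0ℚ :+ q :* con 1ℚ) := q′) refl q q′))
    (ℚₚ.≤-trans (ℚₚ.≤-reflexive (ℚₚ.+-identityʳ _))
      (ℚₚ.≤-trans (ℚₚ.+-monoʳ-≤ q′ (ℚₚ.neg-antimono-≤ 0≤q)) (ℚₚ.≤-reflexive (ℚₚ.+-identityʳ q′))))

  -- One constant must serve every rational q above r. With q = u / d, the bounds are compared after
  -- raising to the power d e, where v / e ≤ p ≤ u / d becomes v d ≤ u e.
  ≼⇒O : {f b : X → ℕ} {p : ℚ} {r : ℝ} → 0ℚ ℚ.≤ p → (∀ q → r <ʳ ℚ⇒ℝ q → p ℚ.≤ q) →
        f ≼ b ^ p → f ∈O[ b ^ r ]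
  ≼⇒O {f} {b} {p} {r} 0≤p r<q⇒p≤q (bound v e K e≢0 v≤ep f≤) = suc K , λ x q r<q →
    let p≤q = r<q⇒p≤q q r<q in claim x q (ℚₚ.≤-trans 0≤p p≤q) p≤q
    where
    claim : ∀ x q → 0ℚ ℚ.≤ q → p ℚ.≤ q → f x ≤ suc K · b x ⊔ 1 ^ℚ q
    claim x q 0≤q p≤q = begin
      f x ^ d * B ^ ((↥ q) ⁻)
        ≡⟨ trans (cong (λ k → f x ^ d * B ^ k) (↥⁻≡0 0≤q)) (*-identityʳ _) ⟩
      f x ^ d                      ≤⟨ ^-cancelˡ-≤ e {{e≢0}} powers ⟩
      suc K ^ d * B ^ u            ∎
      where
      open ≤-Reasoning
      d = ↧ₙ q
      u = (↥ q) ⁺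
      B = b x ⊔ 1
      vd≤ue : v * d ≤ u * e
      vd≤ue = ⌜⌝-cancel-≤ (ℚ-Reasoning.begin
        ⌜ v * d ⌝                            ℚ-Reasoning.≡⟨ ⌜⌝-* v d ⟩
        ⌜ v ⌝ ℚ.* ⌜ d ⌝
          ℚ-Reasoning.≤⟨ ℚₚ.*-monoʳ-≤-nonNeg ⌜ d ⌝ {{ℚ.nonNegative (0≤⌜⌝ d)}}
             (ℚₚ.≤-trans v≤ep (ℚₚ.*-monoˡ-≤-nonNeg ⌜ e ⌝ {{ℚ.nonNegative (0≤⌜⌝ e)}} p≤q)) ⟩
        ⌜ e ⌝ ℚ.* q ℚ.* ⌜ d ⌝
          ℚ-Reasoning.≡⟨ solve 3 (λ e q d → e :* q :* d := (d :* q) :* e) refl ⌜ e ⌝ q ⌜ d ⌝ ⟩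
        (⌜ d ⌝ ℚ.* q) ℚ.* ⌜ e ⌝              ℚ-Reasoning.≡⟨ cong (ℚ._* ⌜ e ⌝) (↧*q≡↥ 0≤q) ⟩
        ⌜ u ⌝ ℚ.* ⌜ e ⌝                      ℚ-Reasoning.≡⟨ ⌜⌝-* u e ⟨
        ⌜ u * e ⌝                            ℚ-Reasoning.∎)
        where
        module ℚ-Reasoning = ℚₚ.≤-Reasoning
      powers : (f x ^ d) ^ e ≤ (suc K ^ d * B ^ u) ^ e
      powers = begin
        (f x ^ d) ^ e                      ≡⟨ ^-swap (f x) d e ⟩
        (f x ^ e) ^ d                      ≤⟨ ^-monoˡ-≤ d (f≤ x) ⟩
        (K * B ^ v) ^ d
          ≡⟨ trans (^-distribʳ-* K (B ^ v) d) (cong (K ^ d *_) (^-*-assoc B v d)) ⟩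
        K ^ d * B ^ (v * d)
          ≤⟨ *-mono-≤ (^-monoˡ-≤ d (≤-trans (n≤1+n K) (m≤m^n (suc K) e {{e≢0}})))
               (^-monoʳ-≤ B {{ℕ.>-nonZero (1≤m⊔1 (b x))}} vd≤ue) ⟩
        (suc K ^ e) ^ d * B ^ (u * e)
          ≡⟨ cong₂ _*_ (^-swap (suc K) e d) (sym (^-*-assoc B u e)) ⟩
        (suc K ^ d) ^ e * (B ^ u) ^ e      ≡⟨ ^-distribʳ-* (suc K ^ d) (B ^ u) e ⟨
        (suc K ^ d * B ^ u) ^ e            ∎

≼-∘ : {X Y : Set} {f b : X → ℕ} {q : ℚ} (h : Y → X) → f ≼ b ^ q → (f ∘ h) ≼ (b ∘ h) ^ q
≼-∘ h (bound u d C d≢0 u≤dq f≤) = bound u d C d≢0 u≤dq (f≤ ∘ h)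

Õ-∘ : {X Y : Set} {f t b s : X → ℕ} {r : ℝ} (h : Y → X) →
      f ∈Õ[ t · b ^ r + s ] → (f ∘ h) ∈Õ[ (t ∘ h) · (b ∘ h) ^ r + (s ∘ h) ]
Õ-∘ h (C , k , f≤) = C , k , λ y → f≤ (h y)

-- A rational strictly between r and q leaves room for the polylogarithm. The maximum with 0 covers
-- negative r, such as a negative α′.
Õ⇒≼₁ : {X : Set} {f b : X → ℕ} (r : ℝ) {q : ℚ} → f ∈Õ[ b ^ r ] → r <ʳ ℚ⇒ℝ q → 0ℚ ℚ.< q → f ≼ b ^ q
Õ⇒≼₁ r {q} f∈ r<q 0<q =
  let q₁ , r<q₁ , q₁<q = <ʳ-dense r (ℚ⇒ℝ q) r<q in
  Õ₁⇒≼ {r = r} {q = q₁ ℚ.⊔ 0ℚ} f∈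
    (<ʳ-≤-trans r {q₁} {q₁ ℚ.⊔ 0ℚ} r<q₁ (ℚₚ.p≤p⊔q q₁ 0ℚ))
    (ℚₚ.p≤q⊔p q₁ 0ℚ)
    (⊔-elim (ℚ._< q) q₁ 0ℚ (<ʳ⇒ℚ-< {q₁} {q} q₁<q) 0<q)

-- Carries a bound from the inputs with a nonempty decomposition to all inputs; the exceptional ones
-- cost at most `c`, which the constant takes up because powers of max(b, 1) are at least 1.
≼-extend : {X Y : Set} {f b : X → ℕ} {g : Y → ℕ} {q : ℚ} (h : Y → X) (c : ℕ) →
           (∀ x → f x ≤ c ⊎ ∃ λ y → h y ≡ x × f x ≤ g y) → g ≼ (b ∘ h) ^ q → f ≼ b ^ q
≼-extend {f = f} {b} {g} h c cover (bound u d C d≢0 u≤dq g≤) =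
  bound u d (C + c ^ d) d≢0 u≤dq λ x → claim x (cover x)
  where
  claim : ∀ x → f x ≤ c ⊎ (∃ λ y → h y ≡ x × f x ≤ g y) → f x ^ d ≤ (C + c ^ d) * (b x ⊔ 1) ^ u
  claim x (inj₁ fx≤c) = begin
    f x ^ d                            ≤⟨ ^-monoˡ-≤ d fx≤c ⟩
    c ^ d                              ≤⟨ m≤n+m (c ^ d) C ⟩
    C + c ^ d
      ≤⟨ m≤m*n (C + c ^ d) ((b x ⊔ 1) ^ u) {{ℕ.>-nonZero (1≤[m⊔1]^n (b x) u)}} ⟩
    (C + c ^ d) * (b x ⊔ 1) ^ u        ∎
    where open ≤-Reasoning
  claim x (inj₂ (y , refl , fx≤gy)) = begin
    f x ^ d                            ≤⟨ ^-monoˡ-≤ d fx≤gy ⟩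
    g y ^ d                            ≤⟨ g≤ y ⟩
    C * (b x ⊔ 1) ^ u                  ≤⟨ *-monoˡ-≤ ((b x ⊔ 1) ^ u) (m≤m+n C (c ^ d)) ⟩
    (C + c ^ d) * (b x ⊔ 1) ^ u        ∎
    where open ≤-Reasoning

-- The algorithm for P and its running time

decideEmpty-decides : ∀ {σ} {P : Problem₁ σ}
                      (𝒜 : Algorithm (λ xs → encodeList {σ} (toList xs)) encodeBool) →
                      Decides 𝒜 (Any P ∘ toList) → Decides (decideEmpty 𝒜) (Any P)
decideEmpty-decides 𝒜 dec []       = mk⇔ (λ ()) (λ ())
decideEmpty-decides 𝒜 dec (x ∷ xs) = dec (x List⁺.∷ xs)

module _ {σ : ℕ} (α ν γ μ ξ β : ℝ) (0<α : 0ʳ <ʳ α) (1<γ : 1ʳ <ʳ γ)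
         (0<μ : 0ʳ <ʳ μ) (0<ξ : 0ʳ <ʳ ξ) (0<β : 0ʳ <ʳ β) (0<ν : 0ʳ <ʳ ν)
         (P : Problem₁ σ) (Q : Problem₂ σ) {l : ℚ} (0<l : 0ℚ ℚ.< l) (E : Exponents α ν γ μ ξ β l)
         (0<λ : 0ʳ <ʳ ℚ⇒ℝ l)
         (decomposition : ORDecompositionAt P α 0<α (ℚ⇒ℝ l) 0<λ)
         (composition : ORCrossComposition P Q ν μ)
         (decider : Algorithm (encode₂ {σ}) encodeBool) (decides : Decides decider Q)
         (decider-time : time decider ∈Õ[ paramⁿ ^ ξ ])
         (∥_∥ : ℕ × ℕ → ℕ) (n≤size : ∀ x → paramⁿ {σ} x ≤ size ∥_∥ x)
         (kernel : Kernel ∥_∥ Q β γ)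
         where

  open Exponents E
  private
    module D = ORDecompositionAt decomposition
    module X = ORCrossComposition composition
    module K = Kernel kernel

    rest : Algorithm (λ xs → encodeList {σ} (toList xs)) encodeBool
    rest = X.algorithm ⨾ᴬ (K.algorithm ⨾ᴬ decider)

    solver : Algorithm (encode₁ {σ}) encodeBool
    solver = D.algorithm ⨾ᴬ decideEmpty rest

    solver-decides : Decides solver P
    solver-decides x =
      decideEmpty-decides rest rest-decides (result D.algorithm x) ⇔-∘ D.equivalent x
      where
      rest-decides : Decides rest (Any P ∘ toList)
      rest-decides xs =
        decides (result K.algorithm (result X.algorithm xs)) ⇔-∘
        (K.equivalent (result X.algorithm xs) ⇔-∘ ⇔-sym (X.equivalent xs))

    0<1ℚ : 0ℚ ℚ.< 1ℚ
    0<1ℚ = ℚₚ.positive⁻¹ 1ℚ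

    0<ν⁺ : 0ℚ ℚ.< ν⁺
    0<ν⁺ = 0<p ν 0<ν ν<ν⁺

    1<γ⁺ : 1ℚ ℚ.< γ⁺
    1<γ⁺ = <ʳ⇒ℚ-< (<ʳ-trans 1ʳ γ (ℚ⇒ℝ γ⁺) 1<γ γ<γ⁺)

    0<γ⁺ : 0ℚ ℚ.< γ⁺
    0<γ⁺ = ℚₚ.<-trans 0<1ℚ 1<γ⁺

    0<w : 0ℚ ℚ.< w
    0<w = ℚₚ.<-trans (ℚₚ.+-mono-< 0<l 0<ν⁺) l+ν⁺<w

    0<z : 0ℚ ℚ.< z
    0<z = ℚₚ.<-trans (pos-* 0<w 0<γ⁺) wγ⁺<z

    -- `x` replaces α / (α + λ) and `a` replaces α′; `a₃` leaves room for the polylogarithm that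
    -- multiplies the lengths of the parts in the composition time.
    module Time (x a a₃ : ℚ) (0<x : 0ℚ ℚ.< x) (c<x : α ÷ʳ (0<-+ α (ℚ⇒ℝ l) 0<α 0<λ) <ʳ ℚ⇒ℝ x)
                (α′<a : D.α′ <ʳ ℚ⇒ℝ a) (0<a : 0ℚ ℚ.< a) (a<a₃ : a ℚ.< a₃) where

      NonEmpty : Set
      NonEmpty = ∃ λ I → ∃ λ xs → result D.algorithm I ≡ toList xs

      n : NonEmpty → ℕ
      n (I , _) = param I

      instances : NonEmpty → List⁺ (Instance₁ σ)
      instances (_ , xs , _) = xs

      composed : NonEmpty → Instance₂ σ
      composed = result X.algorithm ∘ instances

      ρ δ p : ℚ
      -- `δ` is the smaller of the two slacks available to the polylogarithm: below `ρ` in the main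
      -- summand and below `a₃` in the length summand. `p` bounds the exponents of all stages.
      ρ = x ℚ.* w
      δ = (ρ ℚ.- x ℚ.* (l ℚ.+ ν⁺)) ℚ.⊓ (a₃ ℚ.- a)
      p = x ℚ.* z ℚ.⊔ a₃

      instance
        x-pos = ℚ.positive 0<x
        x-nonNeg = ℚ.nonNegative (ℚₚ.<⇒≤ 0<x)

      0<ρ : 0ℚ ℚ.< ρ
      0<ρ = pos-* 0<x 0<w

      -- As γ > 1, the kernel exponent dominates the exponent `ρ` of the composed parameter.
      ρ≤p : ρ ℚ.≤ p
      ρ≤p = ℚₚ.≤-trans
        (ℚₚ.*-monoˡ-≤-nonNeg x (ℚₚ.≤-trans
          (subst (ℚ._≤ w ℚ.* γ⁺) (ℚₚ.*-identityʳ w)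
            (ℚₚ.*-monoˡ-≤-nonNeg w {{ℚ.nonNegative (ℚₚ.<⇒≤ 0<w)}} (ℚₚ.<⇒≤ 1<γ⁺)))
          (ℚₚ.<⇒≤ wγ⁺<z)))
        (ℚₚ.p≤p⊔q (x ℚ.* z) a₃)

      a₃≤p : a₃ ℚ.≤ p
      a₃≤p = ℚₚ.p≤q⊔p (x ℚ.* z) a₃

      0≤p : 0ℚ ℚ.≤ p
      0≤p = ℚₚ.≤-trans (ℚₚ.<⇒≤ 0<ρ) ρ≤p

      0<δ : 0ℚ ℚ.< δ
      0<δ = ⊓-elim (0ℚ ℚ.<_) (ρ ℚ.- x ℚ.* (l ℚ.+ ν⁺)) (a₃ ℚ.- a)
        (p<q⇒0<q-p (ℚₚ.*-monoʳ-<-pos x l+ν⁺<w)) (p<q⇒0<q-p a<a₃)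

      δ-main : δ ℚ.+ (x ℚ.* l ℚ.+ ν⁺ ℚ.* x) ℚ.≤ ρ
      δ-main = ℚₚ.≤-trans (ℚₚ.+-monoˡ-≤ _ (ℚₚ.p⊓q≤p (ρ ℚ.- x ℚ.* (l ℚ.+ ν⁺)) (a₃ ℚ.- a)))
        (ℚₚ.≤-reflexive (solve 4 (λ r x l v → r :- x :* (l :+ v) :+ (x :* l :+ v :* x) := r)
          refl ρ x l ν⁺))

      δ-rest : δ ℚ.+ a ℚ.≤ a₃
      δ-rest = ℚₚ.≤-trans (ℚₚ.+-monoˡ-≤ a (ℚₚ.p⊓q≤q (ρ ℚ.- x ℚ.* (l ℚ.+ ν⁺)) (a₃ ℚ.- a)))
        (ℚₚ.≤-reflexive (solve 2 (λ b a → b :- a :+ a := b) refl a₃ a))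

      decompose-time : time D.algorithm ≼ param ^ a
      decompose-time = Õ⇒≼₁ D.α′ D.time-bound α′<a 0<a

      count≼ : (count ∘ instances) ≼ n ^ (x ℚ.* l)
      count≼ = ≼-mono (λ (I , xs , eq) → ≤-reflexive (cong length (sym eq)))
        (≼-∘ proj₁ (Õ⇒≼₁ (α *ʳ ℚ⇒ℝ l ÷ʳ (0<-+ α (ℚ⇒ℝ l) 0<α 0<λ)) D.count-bound
          (÷-*-<ʳ α (α +ʳ ℚ⇒ℝ l) (0<-+ α (ℚ⇒ℝ l) 0<α 0<λ) x 0<l c<x) (pos-* 0<x 0<l)))

      nₘₐₓ≼ : (nₘₐₓ ∘ instances) ≼ n ^ x
      nₘₐₓ≼ = ≼-mono (λ (I , xs , eq) → ≤-reflexive (cong maxParam (sym eq)))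
        (≼-∘ proj₁ (Õ⇒≼₁ (α ÷ʳ (0<-+ α (ℚ⇒ℝ l) 0<α 0<λ)) D.param-bound c<x 0<x))

      ∑∣I∣≼ : (∑∣I∣ ∘ instances) ≼ n ^ a
      ∑∣I∣≼ = ≼-mono ∑∣I∣≤ (≼-∘ proj₁ decompose-time)
        where
        ∑∣I∣≤ : ∀ y → ∑∣I∣ (instances y) ≤ time D.algorithm (proj₁ y)
        ∑∣I∣≤ (I , xs , eq) = subst (λ ys → totalLength ys ≤ time D.algorithm I) eq
          (≤-trans (totalLength≤encodeList (result D.algorithm I)) (output-length D.algorithm I))

      compose-time : (time X.algorithm ∘ instances) ≼ n ^ p
      compose-time = Õ⇒≼ (Õ-∘ instances X.time-bound) ν<ν⁺ (ℚₚ.<⇒≤ 0<ν⁺) count≼ nₘₐₓ≼ ∑∣I∣≼ 0<δ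
        (ℚₚ.≤-trans δ-main ρ≤p) (ℚₚ.≤-trans δ-rest a₃≤p)

      composed-n≼ : (paramⁿ ∘ composed) ≼ n ^ ρ
      composed-n≼ = Õ⇒≼ (Õ-∘ instances X.n-bound) ν<ν⁺ (ℚₚ.<⇒≤ 0<ν⁺)
        count≼ nₘₐₓ≼ (≼-const 0) 0<δ δ-main
        (ℚₚ.≤-trans (ℚₚ.+-monoʳ-≤ δ (ℚₚ.<⇒≤ (ℚₚ.+-mono-< (pos-* 0<x 0<l) (pos-* 0<ν⁺ 0<x)))) δ-main)

      kernel-time : (time K.algorithm ∘ composed) ≼ n ^ p
      kernel-time = ≼-weaken γ⁺ρ≤p
        (≼-trans (ℚₚ.<⇒≤ 0<ρ) (≼-∘ composed (Õ⇒≼₁ γ K.time-bound γ<γ⁺ 0<γ⁺)) composed-n≼)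
        where
        γ⁺ρ≤p : γ⁺ ℚ.* ρ ℚ.≤ p
        γ⁺ρ≤p = ℚₚ.≤-trans
          (ℚₚ.≤-reflexive (solve 3 (λ g x w → g :* (x :* w) := x :* (w :* g)) refl γ⁺ x w))
          (ℚₚ.≤-trans (ℚₚ.*-monoˡ-≤-nonNeg x (ℚₚ.<⇒≤ wγ⁺<z)) (ℚₚ.p≤p⊔q (x ℚ.* z) a₃))

      decide-time : (time decider ∘ result K.algorithm ∘ composed) ≼ n ^ p
      decide-time = ≼-weaken exponent≤p
        (≼-trans (ℚₚ.<⇒≤ 0<kernel)
          (≼-∘ (result K.algorithm ∘ composed) (Õ⇒≼₁ ξ decider-time ξ<ξ⁺ (0<p ξ 0<ξ ξ<ξ⁺)))
          -- The deciding time is measured in n_Q, while the kernel bounds the size; n_Q ≤ size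
          -- links the two.
          (≼-mono (λ y → n≤size (result K.algorithm (composed y)))
            (≼-trans (ℚₚ.<⇒≤ 0<ℓ) (≼-∘ composed (Õ⇒≼₁ β K.size-bound β<β⁺ (0<p β 0<β β<β⁺)))
              (≼-trans (ℚₚ.<⇒≤ 0<x) (≼-∘ instances (Õ⇒≼₁ μ X.ℓ-bound μ<μ⁺ 0<μ⁺)) nₘₐₓ≼))))
        where
        0<μ⁺ : 0ℚ ℚ.< μ⁺
        0<μ⁺ = 0<p μ 0<μ μ<μ⁺
        0<ℓ : 0ℚ ℚ.< μ⁺ ℚ.* x
        0<ℓ = pos-* 0<μ⁺ 0<x
        0<kernel : 0ℚ ℚ.< β⁺ ℚ.* (μ⁺ ℚ.* x)
        0<kernel = pos-* (0<p β 0<β β<β⁺) 0<ℓ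
        exponent≤p : ξ⁺ ℚ.* (β⁺ ℚ.* (μ⁺ ℚ.* x)) ℚ.≤ p
        exponent≤p = ℚₚ.≤-trans
          (ℚₚ.≤-reflexive (solve 4 (λ k b m x → k :* (b :* (m :* x)) := x :* (b :* (m :* k)))
            refl ξ⁺ β⁺ μ⁺ x))
          (ℚₚ.≤-trans (ℚₚ.*-monoˡ-≤-nonNeg x (ℚₚ.<⇒≤ β⁺μ⁺ξ⁺<z)) (ℚₚ.p≤p⊔q (x ℚ.* z) a₃))

      solver-time : time solver ≼ param ^ p
      solver-time = ≼-+ decompose-time′ (≼-extend proj₁ 3 (λ I → cover I _ refl)
        (≼-+ (≼-+ test-time test-time)
          (≼-+ compose-time (≼-+ kernel-time decide-time))))
        where
        a≤p : a ℚ.≤ p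
        a≤p = ℚₚ.≤-trans (ℚₚ.<⇒≤ a<a₃) a₃≤p
        decompose-time′ : time D.algorithm ≼ param ^ p
        decompose-time′ = ≼-weaken a≤p decompose-time
        -- The length of the encoded list is handled twice, by `len` and by the branch. Its bit
        -- length is estimated crudely by the decomposition time plus 1.
        test-time : (λ y → 1 + time D.algorithm (proj₁ y)) ≼ n ^ p
        test-time = ≼-+ (≼-weaken 0≤p (≼-const 1)) (≼-∘ proj₁ decompose-time′)
        -- The list is abstracted with an equation so that it can be matched on. The constant 3 is
        -- the cost of three steps on the number 0, of one bit each.
        cover : ∀ I xs → result D.algorithm I ≡ xs →
                time (decideEmpty rest) xs ≤ 3 ⊎
                ∃ λ (y : NonEmpty) → proj₁ y ≡ I ×
                  time (decideEmpty rest) xs ≤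
                  (1 + time D.algorithm (proj₁ y) + (1 + time D.algorithm (proj₁ y))) +
                  time rest (instances y)
        cover I []       eq = inj₁ ≤-refl
        cover I (x ∷ xs) eq = inj₂ ((I , x List⁺.∷ xs , eq) , refl ,
          ≤-trans (≤-reflexive (sym (+-assoc b b _))) (+-monoˡ-≤ _ (+-mono-≤ b≤ b≤)))
          where
          b : ℕ
          b = bits (length (encodeList (x ∷ xs)))
          b≤ : b ≤ 1 + time D.algorithm I
          b≤ = ≤-trans (bits≤suc _)
            (s≤s (subst (λ ys → length (encodeList ys) ≤ time D.algorithm I) eq
              (output-length D.algorithm I)))

  solvable : ∃ λ ε → 0ʳ <ʳ ε × (∃ λ (S : Algorithm (encode₁ {σ}) encodeBool) →
               Decides S P × time S ∈O[ param ^ α -ʳ ε ])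
  solvable =
    let x , 0<x , c<x , xz<α = ÷-cut α (α +ʳ ℚ⇒ℝ l) (0<-+ α (ℚ⇒ℝ l) 0<α 0<λ) 0<α 0<z z<α+l
        a₁ , α′<a₁ , a₁<α = <ʳ-dense D.α′ α D.α′<α
        -- α′ need not be positive, so the exponent of the decomposition time is raised to a
        -- positive one still below α.
        a₂ , 0<a₂ , a₂<α = <ʳ-dense 0ʳ α 0<α
        a₃ , a<a₃ , a₃<α = <ʳ-dense (ℚ⇒ℝ (a₁ ℚ.⊔ a₂)) α
          (⊔-elim (λ q → ℚ⇒ℝ q <ʳ α) a₁ a₂ a₁<α a₂<α)
        open Time x (a₁ ℚ.⊔ a₂) a₃ 0<x c<x
          (<ʳ-≤-trans D.α′ {a₁} {a₁ ℚ.⊔ a₂} α′<a₁ (ℚₚ.p≤p⊔q a₁ a₂))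
          (ℚₚ.<-≤-trans (<ʳ⇒ℚ-< {0ℚ} {a₂} 0<a₂) (ℚₚ.p≤q⊔p a₁ a₂))
          (<ʳ⇒ℚ-< {a₁ ℚ.⊔ a₂} {a₃} a<a₃)
        ε , 0<ε , p≤q = gap {p} α (⊔-elim (λ q → ℚ⇒ℝ q <ʳ α) (x ℚ.* z) a₃ xz<α a₃<α)
    in ε , 0<ε , solver , solver-decides , ≼⇒O {r = α -ʳ ε} 0≤p p≤q solver-time

1≤⇒0< : ∀ x → 1ʳ ≤ʳ x → 0ʳ <ʳ x
1≤⇒0< x 1≤x = let N , 1≤x+½ = 1≤x ½ (ℚₚ.positive⁻¹ ½) in
  apart ½ (ℚₚ.positive⁻¹ ½) N λ n n≥ → ℚ-+-cancelʳ-≤ ½ (0ℚ ℚ.+ ½) (seq x n) (1≤x+½ n n≥)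

corollary2p5 :
  (σ : ℕ) (α ν γ μ ξ β : ℝ)
  (ν<α : ν <ʳ α) (1≤ν : 1ʳ ≤ʳ ν) (1<γ : 1ʳ <ʳ γ) (0<μ : 0ʳ <ʳ μ) →
  ν *ʳ γ <ʳ α →
  (P : Problem₁ σ) (Q : Problem₂ σ) →
  ORDecomposable P α (≤-<-trans 1ʳ ν α 1≤ν ν<α) →
  ORCrossComposition P Q ν μ →
  (0<ξ : 0ʳ <ʳ ξ) →
  (∃ λ (D : Algorithm (encode₂ {σ}) encodeBool) →
     Decides D Q × time D ∈Õ[ paramⁿ ^ ξ ]) →
  (∥_∥ : ℕ × ℕ → ℕ) →
  (∀ x → paramⁿ {σ} x ≤ size ∥_∥ x) →
  Kernel ∥_∥ Q β γ →
  0ʳ <ʳ β →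
  β <ʳ γ *ʳ (α -ʳ ν) ÷ʳ
       0<-* ((γ -ʳ 1ʳ) *ʳ μ) ξ (0<-* (γ -ʳ 1ʳ) μ (<⇒0<- 1ʳ γ 1<γ) 0<μ) 0<ξ →
  ∃ λ (ε : ℝ) → 0ʳ <ʳ ε ×
    (∃ λ (S : Algorithm (encode₁ {σ}) encodeBool) →
       Decides S P × time S ∈O[ param ^ α -ʳ ε ])
corollary2p5 σ α ν γ μ ξ β ν<α 1≤ν 1<γ 0<μ νγ<α P Q decomposable composition 0<ξ
  (A , decides , A-time) ∥_∥ n≤size kernel 0<β β< =
  let l , 0<l , kernel< , decision< =
        choose-λ α ν γ μ ξ β (γ -ʳ 1ʳ) (λ _ → refl) (<⇒0<- 1ʳ γ 1<γ) 0<μ 0<ξ νγ<α β<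
      0<λ = ℚ-<⇒<ʳ {0ℚ} {l} 0<l
      0<ν = 1≤⇒0< ν 1≤ν
      0<γ = 0<-trans 1ʳ γ 0<1 1<γ
  in solvable α ν γ μ ξ β (0<-trans 1ʳ α 0<1 (≤-<-trans 1ʳ ν α 1≤ν ν<α)) 1<γ 0<μ 0<ξ 0<β 0<ν P Q
       0<l (exponents α ν γ μ ξ β l 0<l 0<ν 0<γ 0<μ 0<ξ 0<β kernel< decision<)
       0<λ (decomposable (ℚ⇒ℝ l) 0<λ) composition A decides A-time ∥_∥ n≤size kernel
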